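{- For every integer $m\ge 2$, $\pi_f(K_{m,m,m})=\frac{6m}{2m+1}$.
   Context: $K_{m,m,m}$ is the complete tripartite graph with three parts of size $m$. Two edges are nonincident if they share no endpoint. A linear ordering of $V(G)$ separates a pair of nonincident edges if both endpoints of one edge precede both endpoints of the other. $\pi_t(G)$ is the minimum length of a list of linear orderings of $V(G)$ (repetitions allowed) separating every pair of nonincident edges at least $t$ times, and the fractional separation dimension is $\pi_f(G)=\liminf_{t\to\infty}\pi_t(G)/t$. -}

module Defs where

open import Data.Nat using (ℕ; zero; suc; _<_; _≤_; _⊔_; _⊓_; _*_; _+_)
open import Data.Nat.Properties using (_<?_)
open import Data.Fin using (Fin)
open import Data.Product using (_×_; _,_; proj₁; Σ; ∃; ∃-syntax)
open import Data.Sum using (_⊎_)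
open import Data.List using (List; length; filter)
open import Function.Definitions using (Injective)
open import Relation.Binary.PropositionalEquality using (_≡_; _≢_)
open import Relation.Nullary using (Dec)
open import Relation.Nullary.Decidable using (_⊎-dec_)
open import Data.Integer using (+_)
open import Data.Rational using (ℚ; _/_; Positive; _-_) renaming (_+_ to _+ℚ_; _≤_ to _≤ℚ_)

Vertex : ℕ → Set
Vertex m = Fin 3 × Fin m

Adj : ∀ {m} → Vertex m → Vertex m → Set
Adj u v = proj₁ u ≢ proj₁ v

record Edge (m : ℕ) : Set where
  constructor edge
  field
    end₁ : Vertex m
    end₂ : Vertex m
    adj  : Adj end₁ end₂
open Edge public

Nonincident : ∀ {m} → Edge m → Edge m → Set
Nonincident e f =
  (end₁ e ≢ end₁ f) × (end₁ e ≢ end₂ f) × (end₂ e ≢ end₁ f) × (end₂ e ≢ end₂ f)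

-- A linear ordering of V(K_{m,m,m}), given by an injective position map
-- (u precedes v iff pos u < pos v).

record LinearOrdering (m : ℕ) : Set where
  field
    pos : Vertex m → ℕ
    inj : Injective _≡_ _≡_ pos
open LinearOrdering public

Separates : ∀ {m} → LinearOrdering m → Edge m → Edge m → Set
Separates σ e f =
  (pos σ (end₁ e) ⊔ pos σ (end₂ e) < pos σ (end₁ f) ⊓ pos σ (end₂ f)) ⊎
  (pos σ (end₁ f) ⊔ pos σ (end₂ f) < pos σ (end₁ e) ⊓ pos σ (end₂ e))

separates? : ∀ {m} (σ : LinearOrdering m) (e f : Edge m) → Dec (Separates σ e f)
separates? σ e f =
  (pos σ (end₁ e) ⊔ pos σ (end₂ e) <? pos σ (end₁ f) ⊓ pos σ (end₂ f)) ⊎-dec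
  (pos σ (end₁ f) ⊔ pos σ (end₂ f) <? pos σ (end₁ e) ⊓ pos σ (end₂ e))

sepCount : ∀ {m} → List (LinearOrdering m) → Edge m → Edge m → ℕ
sepCount L e f = length (filter (λ σ → separates? σ e f) L)

SeparatesAll : ∀ {m} → ℕ → List (LinearOrdering m) → Set
SeparatesAll t L = ∀ e f → Nonincident e f → t ≤ sepCount L e f

IsPi : ℕ → ℕ → ℕ → Set
IsPi m t k =
  (Σ (List (LinearOrdering m)) λ L → (length L ≡ k) × SeparatesAll t L) ×
  (∀ (L : List (LinearOrdering m)) → SeparatesAll t L → k ≤ length L)

-- π_f(K_{m,m,m}) = q, i.e. liminf_{t→∞} π_t / t = q, with the liminf
-- unfolded (ε ranging over positive rationals, which suffices by density):
--  * for every ε > 0, eventually π_t / t ≥ q - ε;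
--  * for every ε > 0, π_t / t ≤ q + ε for infinitely many t.
-- t ranges over positive integers, written as suc t.

FracSepDimIs : ℕ → ℚ → Set
FracSepDimIs m q =
  (∀ (ε : ℚ) → Positive ε → ∃[ N ] ∀ (t k : ℕ) → N ≤ t → IsPi m (suc t) k →
      q - ε ≤ℚ (+ k) / suc t) ×
  (∀ (ε : ℚ) → Positive ε → ∀ (N : ℕ) → ∃[ t ] ∃[ k ]
      (N ≤ t × IsPi m (suc t) k × ((+ k) / suc t ≤ℚ q +ℚ ε)))

{-# OPTIONS --safe #-}
module Submission where

-- Only pairs of edges {xy, x′z} with exactly one shared part X matter for the lower bound. Scan an
-- ordering from left to right and let c X be the number of vertices of X seen so far. The
-- number of such pairs whose lower edge is completed by a given vertex of X is the increment of a
-- polynomial Ψ(c)/12 minus m/4 · d (d + 1) for each other part Y, where d = c X - c Y. Hence an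
-- ordering separates at most m²(m-1)(2m+1) of them (each counted with its two labellings), and
-- averaging over the 6 m³(m-1) labelled pairs gives length ≥ t · 6m/(2m+1).
-- Every correction vanishes for an ordering made of m blocks, each with one vertex of every part in
-- a fixed order of the parts. The family of all these orderings separates all pairs sharing one part
-- equally often, by symmetry, hence optimally; pairs of edges between the same two parts are
-- separated slightly more often.

open import Data.Bool.Base using (true; false; if_then_else_)
open import Data.Fin.Base using (Fin; zero; suc; toℕ; punchIn; combine)
open import Data.Fin.Patterns using (0F; 1F; 2F)
import Data.Fin.Properties as Fin
open import Data.Integer.Base using (ℤ; +_; -[1+_]; _+_; _-_; _*_; _≤_; +≤+; 0ℤ; 1ℤ)
open import Data.Integer.Properties
open import Data.Integer.Solver using (module +-*-Solver)
open import Data.List.Base as List using (List; []; _∷_; _++_; length; concatMap; allFin; filter; concat; replicate)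
open import Data.Nat.Base as ℕ using (ℕ; zero; suc; _!)
import Data.Nat.Properties as ℕ
open import Data.Product.Base using (∃; _×_; _,_; proj₁; proj₂)
open import Data.Rational.Base as ℚ using (ℚ; _/_; toℚᵘ)
import Data.Rational.Properties as ℚ
open import Data.Rational.Unnormalised.Base as ℚᵘ using (mkℚᵘ)
import Data.Rational.Unnormalised.Properties as ℚᵘ
open import Defs
open import Function.Base using (id; _∘_; const)
open import Function.Bundles using (_↣_; mk↣; module Injection)
open import Relation.Binary.Definitions using (tri<; tri≈; tri>)
open import Relation.Binary.PropositionalEquality hiding ([_])
open import Relation.Nullary using (Dec; does; yes; no; ¬_; contradiction)
open import Relation.Nullary.Decidable using (_⊎-dec_; dec-true; dec-false)
open import Algebra.Properties.Semiring.Sum +-*-semiring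
open +-*-Solver using (Polynomial; solve; con; _:=_; _:+_; _:-_; _:*_)

-- Sums over Fin n

-- The correction comes from an exchange. Let consecutive vertices of X and Y be placed at prefix
-- counts a of X and b of Y. Taking X first instead of Y first changes the two gains together by m
-- (b - a), whatever the count of the third part: the lagging part should come next. The two terms
-- m/4 · d (d + 1) of this pair of parts change together by m (a - b). Gain plus corrections is
-- therefore independent of the order, which is why a potential in the counts exists. Corrections
-- are nonnegative because d is an integer, and they vanish exactly at d = 0 and d = -1: the part of
-- the new vertex is level with each other part or one behind it, as it always is in a block
-- ordering. In the family of block orderings a pair sharing one part is separated with frequency
-- (2m+1)/(6m), and a pair between the same two parts with frequency (2m+2)/(6m). The two bounds
-- meet exactly whenever t is a multiple of the common separation number, so π_t is known there
-- without error, and a liminf asks for no more.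

sum-replicate-* : ∀ n x → sum {n} (const x) ≡ + n * x
sum-replicate-* zero    x = refl
sum-replicate-* (suc n) x = trans (cong (λ y → x + y) (sum-replicate-* n x)) (sym (suc-* (+ n) x))

∑-distrib-- : ∀ {n} (f g : Fin n → ℤ) → ∑[ i < n ] (f i - g i) ≡ sum f - sum g
∑-distrib-- {zero}  f g = refl
∑-distrib-- {suc n} f g = trans (cong (λ y → f zero - g zero + y) (∑-distrib-- (f ∘ suc) (g ∘ suc)))
  (solve 4 (λ a b c d → a :- b :+ (c :- d) := a :+ c :- (b :+ d)) refl (f zero) (g zero) _ _)

∑-punchIn : ∀ {n} (k : Fin (suc n)) (f : Fin (suc n) → ℤ) → ∑[ i < n ] f (punchIn k i) ≡ sum f - f k
∑-punchIn k f = sym (trans (cong (_- f k) (sum-remove {i = k} f))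
  (solve 2 (λ a b → a :+ b :- a := b) refl (f k) _))

∑-mono : ∀ {n} {f g : Fin n → ℤ} → (∀ i → f i ≤ g i) → sum f ≤ sum g
∑-mono {zero}  f≤g = ≤-refl
∑-mono {suc n} f≤g = +-mono-≤ (f≤g zero) (∑-mono (f≤g ∘ suc))

∑-lower : ∀ {n} x {f : Fin n → ℤ} → (∀ i → x ≤ f i) → + n * x ≤ sum f
∑-lower {n} x x≤f = ≤-trans (≤-reflexive (sym (sum-replicate-* n x))) (∑-mono x≤f)

∑∑-cong : ∀ {m n} {f g : Fin m → Fin n → ℤ} → (∀ i j → f i j ≡ g i j) →
          ∑[ i < m ] ∑[ j < n ] f i j ≡ ∑[ i < m ] ∑[ j < n ] g i j
∑∑-cong f≗g = sum-cong-≗ λ i → sum-cong-≗ (f≗g i)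

∑∑-* : ∀ {m n} (f : Fin m → ℤ) (g : Fin n → ℤ) → ∑[ i < m ] ∑[ j < n ] (f i * g j) ≡ sum f * sum g
∑∑-* f g = trans (sum-cong-≗ λ i → sym (*-distribˡ-sum (f i) g)) (sym (*-distribʳ-sum (sum g) f))

∑∑-distrib-- : ∀ {m n} (f g : Fin m → Fin n → ℤ) →
  ∑[ i < m ] ∑[ j < n ] (f i j - g i j) ≡ ∑[ i < m ] ∑[ j < n ] f i j - ∑[ i < m ] ∑[ j < n ] g i j
∑∑-distrib-- f g = trans (sum-cong-≗ λ i → ∑-distrib-- (f i) (g i)) (∑-distrib-- (sum ∘ f) (sum ∘ g))

∑₄ : ∀ m → (Fin m → Fin m → Fin m → Fin m → ℤ) → ℤ
∑₄ m F = ∑[ x < m ] ∑[ y < m ] ∑[ z < m ] ∑[ w < m ] F x y z w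

∑₄-cong : ∀ {m} {F G : Fin m → Fin m → Fin m → Fin m → ℤ} →
          (∀ x y z w → F x y z w ≡ G x y z w) → ∑₄ m F ≡ ∑₄ m G
∑₄-cong F≗G = ∑∑-cong λ x y → ∑∑-cong (F≗G x y)

∑₄-distrib-+ : ∀ {m} (F G : Fin m → Fin m → Fin m → Fin m → ℤ) →
               ∑₄ m (λ x y z w → F x y z w + G x y z w) ≡ ∑₄ m F + ∑₄ m G
∑₄-distrib-+ F G = trans (∑∑-cong λ x y → distrib₂ (F x y) (G x y)) 
  (distrib₂ (λ x y → ∑∑ (F x y)) (λ x y → ∑∑ (G x y)))
  where
  ∑∑ : ∀ {m} → (Fin m → Fin m → ℤ) → ℤ
  ∑∑ {m} f = ∑[ i < m ] ∑[ j < m ] f i j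
  distrib₂ : ∀ {m n} (f g : Fin m → Fin n → ℤ) →
    ∑[ i < m ] ∑[ j < n ] (f i j + g i j) ≡ ∑[ i < m ] ∑[ j < n ] f i j + ∑[ i < m ] ∑[ j < n ] g i j
  distrib₂ f g = trans (sum-cong-≗ λ i → ∑-distrib-+ (f i) (g i)) (∑-distrib-+ (sum ∘ f) (sum ∘ g))

∑₄-* : ∀ {m} (A B : Fin m → Fin m → ℤ) →
       ∑₄ m (λ x y z w → A x y * B z w) ≡ (∑[ x < m ] ∑[ y < m ] A x y) * (∑[ z < m ] ∑[ w < m ] B z w)
∑₄-* {m} A B = begin
  ∑₄ m (λ x y z w → A x y * B z w)
    ≡⟨ ∑∑-cong (λ x y → trans (sum-cong-≗ λ z → sym (*-distribˡ-sum (A x y) (B z)))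
                              (sym (*-distribˡ-sum (A x y) (sum ∘ B)))) ⟩
  ∑[ x < m ] ∑[ y < m ] (A x y * ΣB)
    ≡⟨ sum-cong-≗ (λ x → sym (*-distribʳ-sum ΣB (A x))) ⟩
  ∑[ x < m ] (sum (A x) * ΣB)
    ≡⟨ sym (*-distribʳ-sum ΣB (sum ∘ A)) ⟩
  (∑[ x < m ] ∑[ y < m ] A x y) * ΣB ∎
  where
  open ≡-Reasoning
  ΣB = ∑[ z < m ] ∑[ w < m ] B z w

∑₄-swap-inner : ∀ {m} (F : Fin m → Fin m → Fin m → Fin m → ℤ) →
                ∑₄ m F ≡ ∑₄ m (λ x z y w → F x y z w)
∑₄-swap-inner F = sum-cong-≗ λ x → ∑-comm λ y z → sum (F x y z)

∑₄-swap-halves : ∀ {m} (F : Fin m → Fin m → Fin m → Fin m → ℤ) →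
                 ∑₄ m F ≡ ∑₄ m (λ z w x y → F x y z w)
∑₄-swap-halves {m} F = begin
  ∑₄ m F                            ≡⟨ ∑₄-swap-inner F ⟩
  ∑₄ m (λ x z y w → F x y z w)      ≡⟨ ∑∑-cong (λ x z → ∑-comm λ y w → F x y z w) ⟩
  ∑₄ m (λ x z w y → F x y z w)      ≡⟨ ∑-comm (λ x z → ∑[ w < m ] ∑[ y < m ] F x y z w) ⟩
  ∑₄ m (λ z x w y → F x y z w)      ≡⟨ ∑₄-swap-inner (λ z x w y → F x y z w) ⟩
  ∑₄ m (λ z w x y → F x y z w)      ∎
  where open ≡-Reasoning

-- Sums over an initial segment of ℕ

psum : ℕ → (ℕ → ℤ) → ℤ
psum zero    f = 0ℤ
psum (suc n) f = psum n f + f n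

psum-cong : ∀ n {f g : ℕ → ℤ} → (∀ i → f i ≡ g i) → psum n f ≡ psum n g
psum-cong zero    f≗g = refl
psum-cong (suc n) f≗g = cong₂ _+_ (psum-cong n f≗g) (f≗g n)

psum-distrib-+ : ∀ n (f g : ℕ → ℤ) → psum n (λ i → f i + g i) ≡ psum n f + psum n g
psum-distrib-+ zero    f g = refl
psum-distrib-+ (suc n) f g = trans (cong (_+ (f n + g n)) (psum-distrib-+ n f g))
  (solve 4 (λ a b c d → a :+ b :+ (c :+ d) := a :+ c :+ (b :+ d)) refl (psum n f) (psum n g) (f n) (g n))

∑-psum : ∀ {m} n (f : Fin m → ℕ → ℤ) → ∑[ x < m ] psum n (f x) ≡ psum n (λ i → ∑[ x < m ] f x i)
∑-psum {m} zero f = sum-replicate-zero m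
∑-psum {m} (suc n) f =
  trans (∑-distrib-+ (λ x → psum n (f x)) (λ x → f x n)) (cong (_+ ∑[ x < m ] f x n) (∑-psum n f))

∑₄-psum : ∀ {m} n (F : Fin m → Fin m → Fin m → Fin m → ℕ → ℤ) →
          ∑₄ m (λ x y z w → psum n (F x y z w)) ≡ psum n (λ i → ∑₄ m λ x y z w → F x y z w i)
∑₄-psum {m} n F = begin
  ∑₄ m (λ x y z w → psum n (F x y z w))
    ≡⟨ ∑∑-cong (λ x y → ∑∑-psum (F x y)) ⟩
  ∑[ x < m ] ∑[ y < m ] psum n (λ i → ∑[ z < m ] ∑[ w < m ] F x y z w i)
    ≡⟨ ∑∑-psum (λ x y i → ∑[ z < m ] ∑[ w < m ] F x y z w i) ⟩
  psum n (λ i → ∑₄ m λ x y z w → F x y z w i) ∎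
  where
  open ≡-Reasoning
  ∑∑-psum : (f : Fin m → Fin m → ℕ → ℤ) →
    ∑[ x < m ] ∑[ y < m ] psum n (f x y) ≡ psum n (λ i → ∑[ x < m ] ∑[ y < m ] f x y i)
  ∑∑-psum f = trans (sum-cong-≗ λ x → ∑-psum n (f x)) (∑-psum n λ x i → ∑[ y < m ] f x y i)

-- Indicators of order relations

𝟙 : ∀ {P : Set} → Dec P → ℤ
𝟙 P? = if does P? then 1ℤ else 0ℤ

lt ge : ℕ → ℕ → ℤ
lt a n = 𝟙 (a ℕ.<? n)
ge a n = 1ℤ - lt a n

lt-yes : ∀ {a n} → a ℕ.< n → lt a n ≡ 1ℤ
lt-yes {a} {n} a<n = cong (if_then 1ℤ else 0ℤ) (dec-true (a ℕ.<? n) a<n)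

lt-no : ∀ {a n} → ¬ a ℕ.< n → lt a n ≡ 0ℤ
lt-no {a} {n} a≮n = cong (if_then 1ℤ else 0ℤ) (dec-false (a ℕ.<? n) a≮n)

lt-suc-≢ : ∀ {a n} → a ≢ n → lt a (suc n) ≡ lt a n
lt-suc-≢ {a} {n} a≢n with a ℕ.<? n
... | yes a<n rewrite lt-yes a<n = lt-yes (ℕ.m<n⇒m<1+n a<n)
... | no  a≮n rewrite lt-no a≮n = lt-no λ a<1+n → a≮n (ℕ.≤∧≢⇒< (ℕ.≤-pred a<1+n) a≢n)

lt-⊔ : ∀ a b n → lt (a ℕ.⊔ b) n ≡ lt a n * lt b n
lt-⊔ a b n with a ℕ.<? n | b ℕ.<? n
... | yes a<n | yes b<n rewrite lt-yes a<n | lt-yes b<n = lt-yes (ℕ.⊔-lub a<n b<n)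
... | yes a<n | no b≮n  rewrite lt-yes a<n | lt-no b≮n = lt-no (b≮n ∘ ℕ.m⊔n<o⇒n<o a b)
... | no a≮n  | _       rewrite lt-no a≮n = lt-no (a≮n ∘ ℕ.m⊔n<o⇒m<o a b)

ge-⊓ : ∀ a b n → ge (a ℕ.⊓ b) n ≡ ge a n * ge b n
ge-⊓ a b n with a ℕ.<? n | b ℕ.<? n
... | yes a<n | _       rewrite lt-yes a<n = cong (λ x → 1ℤ - x) (lt-yes (ℕ.m<n⇒m⊓o<n b a<n))
... | no a≮n  | yes b<n rewrite lt-no a≮n | lt-yes b<n = cong (λ x → 1ℤ - x) (lt-yes (ℕ.m<n⇒o⊓m<n a b<n))
... | no a≮n  | no b≮n  rewrite lt-no a≮n | lt-no b≮n =
  cong (λ x → 1ℤ - x) (lt-no (ℕ.≤⇒≯ (ℕ.⊓-glb (ℕ.≮⇒≥ a≮n) (ℕ.≮⇒≥ b≮n))))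

-- `sep` copies the decision made by `separates?`, so that the length of a `filter` becomes a sum of
-- `sep` with no conversion. `below` is one of its two mutually exclusive halves.
below sep : ℕ → ℕ → ℕ → ℕ → ℤ
below a b c d = lt (a ℕ.⊔ b) (c ℕ.⊓ d)
sep a b c d = 𝟙 ((a ℕ.⊔ b ℕ.<? c ℕ.⊓ d) ⊎-dec (c ℕ.⊔ d ℕ.<? a ℕ.⊓ b))

sep≡below+below : ∀ a b c d → sep a b c d ≡ below a b c d + below c d a b
sep≡below+below a b c d with a ℕ.⊔ b ℕ.<? c ℕ.⊓ d | c ℕ.⊔ d ℕ.<? a ℕ.⊓ b
... | yes p | yes q = contradiction (ℕ.<-trans (⊔<⊓ p) (⊔<⊓ q)) (ℕ.<-irrefl refl)
  where
  ⊔<⊓ : ∀ {a b c d} → a ℕ.⊔ b ℕ.< c ℕ.⊓ d → a ℕ.< c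
  ⊔<⊓ {a} {b} {c} {d} p = ℕ.≤-<-trans (ℕ.m≤m⊔n a b) (ℕ.<-≤-trans p (ℕ.m⊓n≤m c d))
... | yes p | no ¬q rewrite dec-true (_ ℕ.<? _) p | dec-false (_ ℕ.<? _) ¬q = refl
... | no ¬p | yes q rewrite dec-false (_ ℕ.<? _) ¬p | dec-true (_ ℕ.<? _) q = refl
... | no ¬p | no ¬q rewrite dec-false (_ ℕ.<? _) ¬p | dec-false (_ ℕ.<? _) ¬q = refl

-- [M < K] as a sum over the position n of M of [n + 1 ≤ K].
lt-psum : ∀ M K N → psum N (λ n → (lt M (suc n) - lt M n) * ge K (suc n)) ≡ lt M N * lt M K
lt-psum M K zero    = refl
lt-psum M K (suc N) rewrite lt-psum M K N with ℕ.<-cmp M N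
... | tri< _ M≢N _ rewrite lt-suc-≢ M≢N =
  solve 3 (λ a b c → a :* b :+ (a :- a) :* c := a :* b) refl (lt M N) (lt M K) (ge K (suc N))
... | tri> _ M≢N _ rewrite lt-suc-≢ M≢N =
  solve 3 (λ a b c → a :* b :+ (a :- a) :* c := a :* b) refl (lt M N) (lt M K) (ge K (suc N))
... | tri≈ _ refl _ rewrite lt-yes (ℕ.n<1+n M) | lt-no (ℕ.<-irrefl {M} refl) with M ℕ.<? K
...   | yes M<K rewrite lt-yes M<K | lt-no {K} {suc M} (ℕ.≤⇒≯ M<K) = refl
...   | no  M≮K rewrite lt-no M≮K | lt-yes {K} {suc M} (ℕ.s≤s (ℕ.≮⇒≥ M≮K)) = refl

-- Maximum and minimum become products of indicators, so each summand is a factor in `a`, `b` times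
-- a factor in `c`, `d`. Sums over independent vertices then split into products of prefix counts.
-- The only nonzero summand can be at the position of the last vertex of the lower edge.
below-psum : ∀ {N} a b c d → a ℕ.< N → b ℕ.< N →
  below a b c d ≡ psum N λ n → (lt a (suc n) * lt b (suc n) - lt a n * lt b n) * (ge c (suc n) * ge d (suc n))
below-psum {N} a b c d a<N b<N = begin
  lt (a ℕ.⊔ b) (c ℕ.⊓ d)                        ≡⟨ sym (*-identityˡ _) ⟩
  1ℤ * lt (a ℕ.⊔ b) (c ℕ.⊓ d)                   ≡⟨ cong (_* below a b c d) (sym (lt-yes (ℕ.⊔-lub a<N b<N))) ⟩
  lt (a ℕ.⊔ b) N * lt (a ℕ.⊔ b) (c ℕ.⊓ d)       ≡⟨ sym (lt-psum (a ℕ.⊔ b) (c ℕ.⊓ d) N) ⟩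
  psum N (λ n → (lt (a ℕ.⊔ b) (suc n) - lt (a ℕ.⊔ b) n) * ge (c ℕ.⊓ d) (suc n))
    ≡⟨ psum-cong N (λ n → cong₂ _*_ (cong₂ _-_ (lt-⊔ a b (suc n)) (lt-⊔ a b n)) (ge-⊓ c d (suc n))) ⟩
  psum N (λ n → (lt a (suc n) * lt b (suc n) - lt a n * lt b n) * (ge c (suc n) * ge d (suc n))) ∎
  where open ≡-Reasoning

sep-swapˡ : ∀ a b c d → sep a b c d ≡ sep b a c d
sep-swapˡ a b c d = cong₂ (λ u v → 𝟙 ((u ℕ.<? c ℕ.⊓ d) ⊎-dec (c ℕ.⊔ d ℕ.<? v))) (ℕ.⊔-comm a b) (ℕ.⊓-comm a b)

sep-swapʳ : ∀ a b c d → sep a b c d ≡ sep a b d c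
sep-swapʳ a b c d = cong₂ (λ u v → 𝟙 ((a ℕ.⊔ b ℕ.<? u) ⊎-dec (v ℕ.<? a ℕ.⊓ b))) (ℕ.⊓-comm c d) (ℕ.⊔-comm c d)

below-irrefl : ∀ a b d → below a b a d ≡ 0ℤ
below-irrefl a b d = lt-no λ p → ℕ.<-irrefl refl (ℕ.≤-<-trans (ℕ.m≤m⊔n a b) (ℕ.<-≤-trans p (ℕ.m⊓n≤m a d)))

-- Edges with a common endpoint are never separated, so later sums may run over all index quadruples
-- without excluding coincidences.
sep-irrefl₁ : ∀ a b d → sep a b a d ≡ 0ℤ
sep-irrefl₁ a b d = trans (sep≡below+below a b a d) (cong₂ _+_ (below-irrefl a b d) (below-irrefl a d b))

sep-irrefl₂ : ∀ a b c → sep a b c b ≡ 0ℤ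
sep-irrefl₂ a b c = trans (sep-swapˡ a b c b) (trans (sep-swapʳ b a c b) (sep-irrefl₁ b a c))

-- The potential of a triple of prefix counts

-- The formulas are needed both over ℤ and as polynomial expressions for the ring solver.
module Formulas {A : Set} (add sub mul : A → A → A) (con : ℤ → A) where
  private
    infixl 6 _⊕_ _⊖_
    infixl 7 _⊗_
    _⊕_ _⊖_ _⊗_ : A → A → A
    _⊕_ = add
    _⊖_ = sub
    _⊗_ = mul

  sumPerms : (Fin 3 → Fin 3 → Fin 3 → A) → A
  sumPerms h = h 0F 1F 2F ⊕ h 0F 2F 1F ⊕ h 1F 0F 2F ⊕ h 1F 2F 0F ⊕ h 2F 0F 1F ⊕ h 2F 1F 0F

  -- If x, y vertices of X, Y lie strictly before a position and x′, y′, z′ vertices of X, Y, Z up to it,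
  -- then this is the number of pairs of an XY-edge whose last vertex is there and a later XZ-edge.
  gain : A → (x y x′ y′ z′ : A) → A
  gain M x y x′ y′ z′ = (x′ ⊗ y′ ⊖ x ⊗ y) ⊗ ((M ⊖ x′) ⊗ (M ⊖ z′))

  totalGain : A → (c c′ : Fin 3 → A) → A
  totalGain M c c′ = sumPerms λ X Y Z → gain M (c X) (c Y) (c′ X) (c′ Y) (c′ Z)

  excess : A → A → A
  excess M d = con (+ 3) ⊗ M ⊗ (d ⊗ (d ⊕ con 1ℤ))

  -- Obtained by summing 12 · totalGain + Σ excess along lattice paths from the origin; the excess makes
  -- the sum path-independent.
  Ψ : A → (Fin 3 → A) → A
  Ψ M c = cube 0F ⊕ cube 1F ⊕ cube 2F ⊕ pair 0F 1F ⊕ pair 0F 2F ⊕ pair 1F 2F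
    ⊕ con (+ 12) ⊗ c 0F ⊗ c 1F ⊗ c 2F ⊗ (c 0F ⊕ c 1F ⊕ c 2F ⊖ con (+ 4) ⊗ M ⊕ con 1ℤ)
    where
    cube : Fin 3 → A
    cube X = con (+ 2) ⊗ M ⊗ (c X ⊗ c X ⊗ c X ⊖ c X)
    pair : Fin 3 → Fin 3 → A
    pair X Y = c X ⊗ c Y ⊗ (con (+ 24) ⊗ M ⊗ M ⊖ con (+ 6) ⊗ M ⊖ con (+ 9) ⊗ M ⊗ (c X ⊕ c Y))

  triple : A → A → A → Fin 3 → A
  triple a b c 0F = a
  triple a b c 1F = b
  triple a b c 2F = c

  -- prefixᵣ k: prefix counts r vertices after k complete blocks.
  prefix₀ prefix₁ prefix₂ prefix₃ : A → Fin 3 → A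
  prefix₀ k X = k
  prefix₁ k   = triple (k ⊕ con 1ℤ) k k
  prefix₂ k   = triple (k ⊕ con 1ℤ) (k ⊕ con 1ℤ) k
  prefix₃ k X = k ⊕ con 1ℤ

  blockTotal : A → A → A
  blockTotal M k = totalGain M (prefix₀ k) (prefix₁ k) ⊕ totalGain M (prefix₁ k) (prefix₂ k) ⊕ totalGain M (prefix₂ k) (prefix₃ k)

  pairGain : A → (c c′ : Fin 3 → A) → Fin 3 → Fin 3 → A
  pairGain M c c′ X Y = gain M (c X) (c Y) (c′ X) (c′ Y) (c′ Y)

  blockPair : Fin 3 → Fin 3 → A → A → A
  blockPair X Y M k = pairGain M (prefix₀ k) (prefix₁ k) X Y ⊕ pairGain M (prefix₁ k) (prefix₂ k) X Y ⊕ pairGain M (prefix₂ k) (prefix₃ k) X Y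

  -- The discrete antiderivative in k of 6 · blockPair.
  Φ : A → A → A
  Φ M k = con (+ 6) ⊗ n ⊗ n ⊗ k ⊕ con (+ 3) ⊗ (con (+ 2) ⊗ n ⊗ n ⊖ n) ⊗ (k ⊗ k ⊖ k)
    ⊖ con (+ 4) ⊗ n ⊗ (con (+ 2) ⊗ k ⊗ k ⊗ k ⊖ con (+ 3) ⊗ k ⊗ k ⊕ k)
    ⊕ con (+ 3) ⊗ k ⊗ k ⊗ (k ⊖ con 1ℤ) ⊗ (k ⊖ con 1ℤ)
    where
    n : A
    n = M ⊖ con 1ℤ

open Formulas _+_ _-_ _*_ id
module Poly {n} = Formulas {Polynomial n} _:+_ _:-_ _:*_ con

sumPerms-cong : ∀ {f g : Fin 3 → Fin 3 → Fin 3 → ℤ} → (∀ X Y Z → f X Y Z ≡ g X Y Z) → sumPerms f ≡ sumPerms g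
sumPerms-cong e = cong₂ _+_ (cong₂ _+_ (cong₂ _+_ (cong₂ _+_ (cong₂ _+_
  (e 0F 1F 2F) (e 0F 2F 1F)) (e 1F 0F 2F)) (e 1F 2F 0F)) (e 2F 0F 1F)) (e 2F 1F 0F)

psum-sumPerms : ∀ N (F : Fin 3 → Fin 3 → Fin 3 → ℕ → ℤ) →
  psum N (λ n → sumPerms λ X Y Z → F X Y Z n) ≡ sumPerms λ X Y Z → psum N (F X Y Z)
psum-sumPerms N F = extend (extend (extend (extend (psum-distrib-+ N _ _))))
  where
  extend : ∀ {f g x} → psum N f ≡ x → psum N (λ n → f n + g n) ≡ x + psum N g
  extend {f} {g} eq = trans (psum-distrib-+ N f g) (cong (_+ psum N g) eq)

-- Prefix counts of a placement are known only pointwise, whereas the ring identities speak of a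
-- `triple` of atoms; this lemma passes from one to the other.
Ψ-cong : ∀ M {c d} → (∀ X → c X ≡ d X) → Ψ M c ≡ Ψ M d
Ψ-cong M {c} {d} c≗d = cong₂ (λ a f → Ψ M (triple a (proj₁ f) (proj₂ f))) (c≗d 0F) (cong₂ _,_ (c≗d 1F) (c≗d 2F))

totalGain-cong : ∀ M {c d c′ d′} → (∀ X → c X ≡ d X) → (∀ X → c′ X ≡ d′ X) → totalGain M c c′ ≡ totalGain M d d′
totalGain-cong M {c} {d} {c′} {d′} c≗d c′≗d′ =
  cong₂ (λ f g → totalGain M (fun f) (fun g)) (eq c≗d) (eq c′≗d′)
  where
  fun : ℤ × ℤ × ℤ → Fin 3 → ℤ
  fun (a , b , c) = triple a b c
  eq : ∀ {c d : Fin 3 → ℤ} → (∀ X → c X ≡ d X) → (c 0F , c 1F , c 2F) ≡ (d 0F , d 1F , d 2F)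
  eq c≗d = cong₂ _,_ (c≗d 0F) (cong₂ _,_ (c≗d 1F) (c≗d 2F))

-- The discrete derivative of `Ψ` in one coordinate. The differences in the excess do not yet count
-- the new vertex, so a part that is level with another or one behind it pays nothing.
Ψ-step₀ : ∀ M a b c → Ψ M (triple (a + 1ℤ) b c) ≡
  Ψ M (triple a b c) + (+ 12 * totalGain M (triple a b c) (triple (a + 1ℤ) b c) + (excess M (a - b) + excess M (a - c)))
Ψ-step₀ = solve 4 (λ M a b c → let p = Poly.triple a b c; p′ = Poly.triple (a :+ con 1ℤ) b c in
  Poly.Ψ M p′ := Poly.Ψ M p :+ (con (+ 12) :* Poly.totalGain M p p′ :+ (Poly.excess M (a :- b) :+ Poly.excess M (a :- c)))) refl

Ψ-step₁ : ∀ M a b c → Ψ M (triple a (b + 1ℤ) c) ≡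
  Ψ M (triple a b c) + (+ 12 * totalGain M (triple a b c) (triple a (b + 1ℤ) c) + (excess M (b - a) + excess M (b - c)))
Ψ-step₁ = solve 4 (λ M a b c → let p = Poly.triple a b c; p′ = Poly.triple a (b :+ con 1ℤ) c in
  Poly.Ψ M p′ := Poly.Ψ M p :+ (con (+ 12) :* Poly.totalGain M p p′ :+ (Poly.excess M (b :- a) :+ Poly.excess M (b :- c)))) refl

Ψ-step₂ : ∀ M a b c → Ψ M (triple a b (c + 1ℤ)) ≡
  Ψ M (triple a b c) + (+ 12 * totalGain M (triple a b c) (triple a b (c + 1ℤ)) + (excess M (c - a) + excess M (c - b)))
Ψ-step₂ = solve 4 (λ M a b c → let p = Poly.triple a b c; p′ = Poly.triple a b (c :+ con 1ℤ) in
  Poly.Ψ M p′ := Poly.Ψ M p :+ (con (+ 12) :* Poly.totalGain M p p′ :+ (Poly.excess M (c :- a) :+ Poly.excess M (c :- b)))) refl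

Ψ-start : ∀ M → Ψ M (const 0ℤ) ≡ 0ℤ
Ψ-start = solve 1 (λ M → Poly.Ψ M (const (con 0ℤ)) := con 0ℤ) refl

Ψ-end : ∀ M → Ψ M (const M) ≡ + 6 * (M * M * (M - 1ℤ) * (+ 2 * M + 1ℤ))
Ψ-end = solve 1 (λ M → Poly.Ψ M (const M) :=
  con (+ 6) :* (M :* M :* (M :- con 1ℤ) :* (con (+ 2) :* M :+ con 1ℤ))) refl

totalGain-const : ∀ M a b c → + 12 * totalGain M (triple a b c) (triple a b c) ≡ 0ℤ
totalGain-const = solve 4 (λ M a b c → let p = Poly.triple a b c in
  con (+ 12) :* Poly.totalGain M p p := con 0ℤ) refl

-- Integrality enters here: the product is negative strictly between -1 and 0 and vanishes at both
-- ends.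
d*[d+1]-nonneg : ∀ d → 0ℤ ≤ d * (d + 1ℤ)
d*[d+1]-nonneg (+ n)          = ≤-trans (+≤+ ℕ.z≤n) (≤-reflexive (pos-* n (n ℕ.+ 1)))
d*[d+1]-nonneg -[1+ zero ]    = ≤-refl
d*[d+1]-nonneg -[1+ suc n ]   = +≤+ ℕ.z≤n

excess-nonneg : ∀ m d → 0ℤ ≤ excess (+ m) d
excess-nonneg m d = begin
  0ℤ                               ≡⟨ sym (*-zeroʳ (+ (3 ℕ.* m))) ⟩
  + (3 ℕ.* m) * 0ℤ                 ≤⟨ *-monoˡ-≤-nonNeg (+ (3 ℕ.* m)) (d*[d+1]-nonneg d) ⟩
  + (3 ℕ.* m) * (d * (d + 1ℤ))     ≡⟨ cong (_* (d * (d + 1ℤ))) (pos-* 3 m) ⟩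
  + 3 * + m * (d * (d + 1ℤ))       ∎
  where open ≤-Reasoning

-- Positions are arbitrary naturals, so a scan over all `n` also meets values that no vertex takes;
-- `stay` covers these gaps.
data UnitStep (c c′ : Fin 3 → ℤ) : Set where
  stay : (∀ X → c′ X ≡ c X) → UnitStep c c′
  move : ∀ X → c′ X ≡ c X + 1ℤ → (∀ Y → Y ≢ X → c′ Y ≡ c Y) → UnitStep c c′

gain≤ΔΨ : ∀ m {c c′} → UnitStep c c′ → Ψ (+ m) c + + 12 * totalGain (+ m) c c′ ≤ Ψ (+ m) c′
gain≤ΔΨ m {c} {c′} (stay c′≗c) = ≤-reflexive (begin
  Ψ (+ m) c + + 12 * totalGain (+ m) c c′
    ≡⟨ cong (λ g → Ψ (+ m) c + + 12 * g) (totalGain-cong (+ m) {c} {c} {c′} {c} (λ _ → refl) c′≗c) ⟩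
  Ψ (+ m) c + + 12 * totalGain (+ m) c c
    ≡⟨ cong (λ g → Ψ (+ m) c + g) (totalGain-const (+ m) (c 0F) (c 1F) (c 2F)) ⟩
  Ψ (+ m) c + 0ℤ
    ≡⟨ +-identityʳ (Ψ (+ m) c) ⟩
  Ψ (+ m) c
    ≡⟨ sym (Ψ-cong (+ m) {c′} {c} c′≗c) ⟩
  Ψ (+ m) c′ ∎)
  where open ≡-Reasoning
gain≤ΔΨ m {c} {c′} (move X c′X≡ c′Y≡) = step X c′X≡ c′Y≡
  where
  a = c 0F
  b = c 1F
  e = c 2F
  conclude : ∀ {d} x y → (∀ X → c′ X ≡ d X) →
    Ψ (+ m) d ≡ Ψ (+ m) c + (+ 12 * totalGain (+ m) c d + (excess (+ m) x + excess (+ m) y)) →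
    Ψ (+ m) c + + 12 * totalGain (+ m) c c′ ≤ Ψ (+ m) c′
  conclude {d} x y c′≗d eq = begin
    Ψ (+ m) c + + 12 * totalGain (+ m) c c′
      ≡⟨ cong (λ g → Ψ (+ m) c + + 12 * g) (totalGain-cong (+ m) {c} {c} {c′} {d} (λ _ → refl) c′≗d) ⟩
    Ψ (+ m) c + + 12 * totalGain (+ m) c d
      ≡⟨ cong (λ g → Ψ (+ m) c + g) (sym (+-identityʳ _)) ⟩
    Ψ (+ m) c + (+ 12 * totalGain (+ m) c d + (0ℤ + 0ℤ))
      ≤⟨ +-monoʳ-≤ (Ψ (+ m) c) (+-monoʳ-≤ (+ 12 * totalGain (+ m) c d)
           (+-mono-≤ (excess-nonneg m x) (excess-nonneg m y))) ⟩
    Ψ (+ m) c + (+ 12 * totalGain (+ m) c d + (excess (+ m) x + excess (+ m) y))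
      ≡⟨ sym eq ⟩
    Ψ (+ m) d
      ≡⟨ sym (Ψ-cong (+ m) {c′} {d} c′≗d) ⟩
    Ψ (+ m) c′ ∎
    where open ≤-Reasoning
  step : ∀ X → c′ X ≡ c X + 1ℤ → (∀ Y → Y ≢ X → c′ Y ≡ c Y) →
         Ψ (+ m) c + + 12 * totalGain (+ m) c c′ ≤ Ψ (+ m) c′
  step 0F p q = conclude {triple (a + 1ℤ) b e} (a - b) (a - e)
    (λ { 0F → p ; 1F → q 1F (λ ()) ; 2F → q 2F (λ ()) }) (Ψ-step₀ (+ m) a b e)
  step 1F p q = conclude {triple a (b + 1ℤ) e} (b - a) (b - e)
    (λ { 0F → q 0F (λ ()) ; 1F → p ; 2F → q 2F (λ ()) }) (Ψ-step₁ (+ m) a b e)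
  step 2F p q = conclude {triple a b (e + 1ℤ)} (e - a) (e - b)
    (λ { 0F → q 0F (λ ()) ; 1F → q 1F (λ ()) ; 2F → p }) (Ψ-step₂ (+ m) a b e)

-- Separated pairs of a placement

module Placement {m : ℕ} (P : Fin 3 → Fin m → ℕ) where

  count : ℕ → Fin 3 → ℤ
  count n X = ∑[ x < m ] lt (P X x) n

  -- The index orders differ on purpose. `#below` groups indices by edge, so that the quadruple sum
  -- factors; `#sep` puts the two vertices of the shared part first, where the averages need them.
  #below #sep : Fin 3 → Fin 3 → Fin 3 → ℤ
  #below X Y Z = ∑₄ m λ x y x′ z → below (P X x) (P Y y) (P X x′) (P Z z)
  #sep   X Y Z = ∑₄ m λ x x′ y z → sep (P X x) (P Y y) (P X x′) (P Z z)

  #sep≡#below+#below : ∀ X Y Z → #sep X Y Z ≡ #below X Y Z + #below X Z Y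
  #sep≡#below+#below X Y Z = begin
    #sep X Y Z
      ≡⟨ ∑₄-swap-inner (λ x x′ y z → sep (P X x) (P Y y) (P X x′) (P Z z)) ⟩
    ∑₄ m (λ x y x′ z → sep (P X x) (P Y y) (P X x′) (P Z z))
      ≡⟨ ∑₄-cong (λ x y x′ z → sep≡below+below (P X x) (P Y y) (P X x′) (P Z z)) ⟩
    ∑₄ m (λ x y x′ z → below (P X x) (P Y y) (P X x′) (P Z z) + below (P X x′) (P Z z) (P X x) (P Y y))
      ≡⟨ ∑₄-distrib-+ (λ x y x′ z → below (P X x) (P Y y) (P X x′) (P Z z))
                      (λ x y x′ z → below (P X x′) (P Z z) (P X x) (P Y y)) ⟩
    #below X Y Z + ∑₄ m (λ x y x′ z → below (P X x′) (P Z z) (P X x) (P Y y))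
      ≡⟨ cong (λ s → #below X Y Z + s) (∑₄-swap-halves λ x y x′ z → below (P X x′) (P Z z) (P X x) (P Y y)) ⟩
    #below X Y Z + #below X Z Y ∎
    where open ≡-Reasoning

  -- Each `#below` enters twice, once for either naming of the two parts that are not shared.
  sumPerms-#sep : sumPerms #sep ≡ + 2 * sumPerms #below
  sumPerms-#sep = begin
    sumPerms #sep ≡⟨ sumPerms-cong #sep≡#below+#below ⟩
    sumPerms (λ X Y Z → #below X Y Z + #below X Z Y)
      ≡⟨ solve 6 (λ a b c d e f →
           a :+ b :+ (b :+ a) :+ (c :+ d) :+ (d :+ c) :+ (e :+ f) :+ (f :+ e)
             := con (+ 2) :* (a :+ b :+ c :+ d :+ e :+ f)) refl
           (#below 0F 1F 2F) (#below 0F 2F 1F) (#below 1F 0F 2F) (#below 1F 2F 0F) (#below 2F 0F 1F) (#below 2F 1F 0F) ⟩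
    + 2 * sumPerms #below ∎
    where open ≡-Reasoning

  stepGain : Fin 3 → Fin 3 → Fin 3 → ℕ → ℤ
  stepGain X Y Z n = gain (+ m) (count n X) (count n Y) (count (suc n) X) (count (suc n) Y) (count (suc n) Z)

  ∑-ge : ∀ n X → ∑[ x < m ] ge (P X x) n ≡ + m - count n X
  ∑-ge n X = trans (∑-distrib-- {m} (const 1ℤ) (λ x → lt (P X x) n))
    (cong (_- count n X) (trans (sum-replicate-* m 1ℤ) (*-identityʳ (+ m))))

  #below-psum : ∀ {N} → (∀ X x → P X x ℕ.< N) → ∀ X Y Z → #below X Y Z ≡ psum N (stepGain X Y Z)
  #below-psum {N} P<N X Y Z = begin
    #below X Y Z
      ≡⟨ ∑₄-cong (λ x y x′ z → below-psum (P X x) (P Y y) (P X x′) (P Z z) (P<N X x) (P<N Y y)) ⟩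
    ∑₄ m (λ x y x′ z → psum N λ n → completed n x y * later n x′ z)
      ≡⟨ ∑₄-psum N (λ x y x′ z n → completed n x y * later n x′ z) ⟩
    psum N (λ n → ∑₄ m λ x y x′ z → completed n x y * later n x′ z)
      ≡⟨ psum-cong N (λ n → trans (∑₄-* (completed n) (later n)) (cong₂ _*_ (∑-completed n) (∑-later n))) ⟩
    psum N (stepGain X Y Z) ∎
    where
    open ≡-Reasoning
    completed later : ℕ → Fin m → Fin m → ℤ
    completed n x y = lt (P X x) (suc n) * lt (P Y y) (suc n) - lt (P X x) n * lt (P Y y) n
    later n x′ z = ge (P X x′) (suc n) * ge (P Z z) (suc n)
    ∑-completed : ∀ n → ∑[ x < m ] ∑[ y < m ] completed n x y ≡
                  count (suc n) X * count (suc n) Y - count n X * count n Y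
    ∑-completed n = trans
      (∑∑-distrib-- (λ x y → lt (P X x) (suc n) * lt (P Y y) (suc n)) (λ x y → lt (P X x) n * lt (P Y y) n))
      (cong₂ _-_ (∑∑-* (λ x → lt (P X x) (suc n)) (λ y → lt (P Y y) (suc n)))
                 (∑∑-* (λ x → lt (P X x) n) (λ y → lt (P Y y) n)))
    ∑-later : ∀ n → ∑[ x < m ] ∑[ z < m ] later n x z ≡ (+ m - count (suc n) X) * (+ m - count (suc n) Z)
    ∑-later n = trans (∑∑-* (λ x → ge (P X x) (suc n)) (λ z → ge (P Z z) (suc n)))
      (cong₂ _*_ (∑-ge (suc n) X) (∑-ge (suc n) Z))

  sumPerms-#below : ∀ {N} → (∀ X x → P X x ℕ.< N) →
    sumPerms #below ≡ psum N (λ n → totalGain (+ m) (count n) (count (suc n)))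
  sumPerms-#below {N} P<N = trans (sumPerms-cong (#below-psum P<N)) (sym (psum-sumPerms N stepGain))

  count-start : ∀ X → count 0 X ≡ 0ℤ
  count-start X = sum-replicate-zero m

  count-end : ∀ {N} → (∀ X x → P X x ℕ.< N) → ∀ X → count N X ≡ + m
  count-end P<N X = trans (sum-cong-≗ λ x → lt-yes (P<N X x)) (trans (sum-replicate-* m 1ℤ) (*-identityʳ (+ m)))

  module _ (P-injective : ∀ {X Y x y} → P X x ≡ P Y y → (X , x) ≡ (Y , y)) where

    count-suc : ∀ n X → (∀ x → P X x ≢ n) → count (suc n) X ≡ count n X
    count-suc n X P≢n = sum-cong-≗ λ x → lt-suc-≢ (P≢n x)

    unitStep : ∀ n → UnitStep (count n) (count (suc n))
    unitStep n with Fin.any? (λ X → Fin.any? λ x → P X x ℕ.≟ n)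
    ... | no ∄ = stay λ X → count-suc n X λ x p → ∄ (X , x , p)
    ... | yes (X , x , PXx≡n) = move X (count-at x PXx≡n)
            λ Y Y≢X → count-suc n Y λ y p → Y≢X (cong proj₁ (P-injective (trans p (sym PXx≡n))))
      where
      split : ∀ {k} (f g : Fin k → ℤ) (x : Fin k) → f x ≡ g x + 1ℤ → (∀ y → y ≢ x → f y ≡ g y) → sum f ≡ sum g + 1ℤ
      split {suc k} f g x fx f≗g = begin
        sum f                                         ≡⟨ sum-remove {i = x} f ⟩
        f x + ∑[ y < k ] f (punchIn x y)              ≡⟨ cong₂ _+_ fx (sum-cong-≗ λ y → f≗g (punchIn x y) (Fin.punchInᵢ≢i x y)) ⟩
        g x + 1ℤ + ∑[ y < k ] g (punchIn x y)         ≡⟨ solve 2 (λ a b → a :+ con 1ℤ :+ b := a :+ b :+ con 1ℤ) refl (g x) _ ⟩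
        g x + ∑[ y < k ] g (punchIn x y) + 1ℤ         ≡⟨ cong (_+ 1ℤ) (sym (sum-remove {i = x} g)) ⟩
        sum g + 1ℤ                                    ∎
        where open ≡-Reasoning
      count-at : ∀ x → P X x ≡ n → count (suc n) X ≡ count n X + 1ℤ
      count-at x refl = split _ _ x
        (trans (lt-yes (ℕ.n<1+n n)) (cong (_+ 1ℤ) (sym (lt-no {n} {n} (ℕ.<-irrefl refl)))))
        λ y y≢x → lt-suc-≢ λ p → y≢x (cong proj₂ (P-injective p))

    psum-gain≤Ψ : ∀ N → + 12 * psum N (λ n → totalGain (+ m) (count n) (count (suc n))) ≤ Ψ (+ m) (count N)
    psum-gain≤Ψ zero    = ≤-reflexive (sym (trans (Ψ-cong (+ m) {count 0} {const 0ℤ} count-start) (Ψ-start (+ m))))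
    psum-gain≤Ψ (suc N) = begin
      + 12 * (psum N g + g N)         ≡⟨ *-distribˡ-+ (+ 12) (psum N g) (g N) ⟩
      + 12 * psum N g + + 12 * g N    ≤⟨ +-monoˡ-≤ (+ 12 * g N) (psum-gain≤Ψ N) ⟩
      Ψ (+ m) (count N) + + 12 * g N  ≤⟨ gain≤ΔΨ m (unitStep N) ⟩
      Ψ (+ m) (count (suc N))         ∎
      where
      open ≤-Reasoning
      g : ℕ → ℤ
      g n = totalGain (+ m) (count n) (count (suc n))

    -- The potential starts at zero and ends at the value for full counts, which is the same for
    -- every ordering. Twelve times the `#below` sum is six times the `#sep` sum, which explains the
    -- cancelled 6.
    sumPerms-#sep-bound : ∀ {N} → (∀ X x → P X x ℕ.< N) →
      sumPerms #sep ≤ + m * + m * (+ m - 1ℤ) * (+ 2 * + m + 1ℤ)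
    sumPerms-#sep-bound {N} P<N = *-cancelˡ-≤-pos _ _ (+ 6) (begin
      + 6 * sumPerms #sep                ≡⟨ cong (+ 6 *_) sumPerms-#sep ⟩
      + 6 * (+ 2 * sumPerms #below)      ≡⟨ sym (*-assoc (+ 6) (+ 2) (sumPerms #below)) ⟩
      + 12 * sumPerms #below             ≡⟨ cong (+ 12 *_) (sumPerms-#below P<N) ⟩
      + 12 * psum N (λ n → totalGain (+ m) (count n) (count (suc n)))  ≤⟨ psum-gain≤Ψ N ⟩
      Ψ (+ m) (count N)                  ≡⟨ Ψ-cong (+ m) {count N} {const (+ m)} (count-end P<N) ⟩
      Ψ (+ m) (const (+ m))              ≡⟨ Ψ-end (+ m) ⟩
      + 6 * (+ m * + m * (+ m - 1ℤ) * (+ 2 * + m + 1ℤ)) ∎)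
      where open ≤-Reasoning

-- The block placement

block : ∀ {m} → Fin 3 → Fin m → ℕ
block X i = toℕ i ℕ.* 3 ℕ.+ toℕ X

block≡combine : ∀ {m} X (i : Fin m) → block X i ≡ toℕ (combine i X)
block≡combine X i = trans (cong (ℕ._+ toℕ X) (ℕ.*-comm (toℕ i) 3)) (sym (Fin.toℕ-combine i X))

block-injective : ∀ {m} {X Y} {i j : Fin m} → block X i ≡ block Y j → i ≡ j × X ≡ Y
block-injective {X = X} {Y} {i} {j} eq = Fin.combine-injective i X j Y
  (Fin.toℕ-injective (trans (sym (block≡combine X i)) (trans eq (block≡combine Y j))))

block<m*3 : ∀ {m} X (i : Fin m) → block X i ℕ.< m ℕ.* 3
block<m*3 X i = subst (ℕ._< _) (sym (block≡combine X i)) (Fin.toℕ<n (combine i X))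

-- The number of vertices of part `X` among the first `r` of a block whose parts stand in the order
-- 0, 1, 2.
early : Fin 3 → Fin 3 → ℕ
early X r = if does (X Fin.<? r) then 1 else 0

-- Removing a whole block from both positions does not affect either comparison, by computation;
-- only comparisons involving block 0 are left.
lt-block : ∀ X r j k → lt (j ℕ.* 3 ℕ.+ toℕ X) (k ℕ.* 3 ℕ.+ toℕ r) ≡ lt j (k ℕ.+ early X r)
lt-block 0F 0F zero zero = refl
lt-block 0F 1F zero zero = refl
lt-block 0F 2F zero zero = refl
lt-block 1F 0F zero zero = refl
lt-block 1F 1F zero zero = refl
lt-block 1F 2F zero zero = refl
lt-block 2F 0F zero zero = refl
lt-block 2F 1F zero zero = refl
lt-block 2F 2F zero zero = refl
lt-block 0F r zero (suc k) = refl
lt-block 1F r zero (suc k) = refl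
lt-block 2F r zero (suc k) = refl
lt-block X 0F (suc j) zero = refl
lt-block 0F 1F (suc j) zero = refl
lt-block 1F 1F (suc j) zero = refl
lt-block 2F 1F (suc j) zero = refl
lt-block 0F 2F (suc j) zero = refl
lt-block 1F 2F (suc j) zero = refl
lt-block 2F 2F (suc j) zero = refl
lt-block X r (suc j) (suc k) = lt-block X r j k

early≤1 : ∀ X r → early X r ℕ.≤ 1
early≤1 X r with does (X Fin.<? r)
... | true  = ℕ.≤-refl
... | false = ℕ.z≤n

∑-lt : ∀ {m k} → k ℕ.≤ m → ∑[ i < m ] lt (toℕ i) k ≡ + k
∑-lt {m}     {zero}  _           = sum-replicate-zero m
∑-lt {suc m} {suc k} (ℕ.s≤s k≤m) = cong (λ x → 1ℤ + x) (∑-lt k≤m)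

-- At block boundaries all three counts agree, so the antiderivative `R` may depend on the number of
-- blocks alone. The multiplier `c` clears its denominators.
telescope : ∀ c (R : ℕ → ℤ) F n → R 0 ≡ 0ℤ →
  (∀ k → k ℕ.< n → R (suc k) ≡ R k + c * (F (k ℕ.* 3) + F (1 ℕ.+ k ℕ.* 3) + F (2 ℕ.+ k ℕ.* 3))) →
  c * psum (n ℕ.* 3) F ≡ R n
telescope c R F zero    R₀ ΔR = trans (*-zeroʳ c) (sym R₀)
telescope c R F (suc n) R₀ ΔR = begin
  c * (psum (n ℕ.* 3) F + f₀ + f₁ + f₂)
    ≡⟨ solve 5 (λ c s a b d → c :* (s :+ a :+ b :+ d) := c :* s :+ c :* (a :+ b :+ d)) refl c (psum (n ℕ.* 3) F) f₀ f₁ f₂ ⟩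
  c * psum (n ℕ.* 3) F + c * (f₀ + f₁ + f₂)
    ≡⟨ cong (_+ c * (f₀ + f₁ + f₂)) (telescope c R F n R₀ λ k k<n → ΔR k (ℕ.m<n⇒m<1+n k<n)) ⟩
  R n + c * (f₀ + f₁ + f₂)
    ≡⟨ sym (ΔR n (ℕ.n<1+n n)) ⟩
  R (suc n) ∎
  where
  open ≡-Reasoning
  f₀ = F (n ℕ.* 3)
  f₁ = F (1 ℕ.+ n ℕ.* 3)
  f₂ = F (2 ℕ.+ n ℕ.* 3)

-- Within a block, the new vertex sees d = 0 against parts still to come and d = -1 against parts
-- already placed. No excess arises, and the potential grows by the gain alone.
ΔΨ-block : ∀ M k → Ψ M (const (k + 1ℤ)) ≡ Ψ M (const k) + + 12 * blockTotal M k
ΔΨ-block = solve 2 (λ M k → Poly.Ψ M (const (k :+ con 1ℤ)) := Poly.Ψ M (const k) :+ con (+ 12) :* Poly.blockTotal M k) refl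

-- One `Φ` serves all six ordered pairs: the step of the third part completes no XY-edge, and the
-- gain is symmetric in `X` and `Y`, so their order within the block is immaterial.
ΔΦ-block : ∀ X Y → X ≢ Y → ∀ M k → Φ M (k + 1ℤ) ≡ Φ M k + + 6 * blockPair X Y M k
ΔΦ-block X Y X≢Y = go X Y X≢Y
  where
  equation : Fin 3 → Fin 3 → Polynomial 2 → Polynomial 2 → Polynomial 2 × Polynomial 2
  equation X Y M k = Poly.Φ M (k :+ con 1ℤ) := Poly.Φ M k :+ con (+ 6) :* Poly.blockPair X Y M k
  go : ∀ X Y → X ≢ Y → ∀ M k → Φ M (k + 1ℤ) ≡ Φ M k + + 6 * blockPair X Y M k
  go 0F 0F 0≢0 = contradiction refl 0≢0
  go 0F 1F _   = solve 2 (equation 0F 1F) refl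
  go 0F 2F _   = solve 2 (equation 0F 2F) refl
  go 1F 0F _   = solve 2 (equation 1F 0F) refl
  go 1F 1F 1≢1 = contradiction refl 1≢1
  go 1F 2F _   = solve 2 (equation 1F 2F) refl
  go 2F 0F _   = solve 2 (equation 2F 0F) refl
  go 2F 1F _   = solve 2 (equation 2F 1F) refl
  go 2F 2F 2≢2 = contradiction refl 2≢2

Φ-start : ∀ M → Φ M 0ℤ ≡ 0ℤ
Φ-start = solve 1 (λ M → Poly.Φ M (con 0ℤ) := con 0ℤ) refl

Φ-end : ∀ M → Φ M M ≡ M * (M + 1ℤ) * ((M - 1ℤ) * (M - 1ℤ))
Φ-end = solve 1 (λ M → Poly.Φ M M := M :* (M :+ con 1ℤ) :* ((M :- con 1ℤ) :* (M :- con 1ℤ))) refl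

module BlockPlacement (m : ℕ) where
  open Placement {m} block public

  private
    count-block : ∀ {k} → k ℕ.< m → ∀ r X → count (k ℕ.* 3 ℕ.+ toℕ r) X ≡ + (k ℕ.+ early X r)
    count-block {k} k<m r X = trans (sum-cong-≗ {m} λ i → lt-block X r (toℕ i) k)
      (∑-lt (ℕ.≤-trans (ℕ.+-monoʳ-≤ k (early≤1 X r)) (subst (ℕ._≤ m) (ℕ.+-comm 1 k) k<m)))

    count-block′ : ∀ {k} → k ℕ.< m → ∀ r X → count (toℕ r ℕ.+ k ℕ.* 3) X ≡ + (k ℕ.+ early X r)
    count-block′ {k} k<m r X = trans (cong (λ n → count n X) (ℕ.+-comm (toℕ r) (k ℕ.* 3))) (count-block k<m r X)

    module _ {k} (k<m : k ℕ.< m) where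
      at₀ : ∀ X → count (k ℕ.* 3) X ≡ prefix₀ (+ k) X
      at₀ X = trans (count-block′ k<m 0F X) (cong +_ (ℕ.+-identityʳ k))

      at₁ : ∀ X → count (1 ℕ.+ k ℕ.* 3) X ≡ prefix₁ (+ k) X
      at₁ 0F = count-block′ k<m 1F 0F
      at₁ 1F = trans (count-block′ k<m 1F 1F) (cong +_ (ℕ.+-identityʳ k))
      at₁ 2F = trans (count-block′ k<m 1F 2F) (cong +_ (ℕ.+-identityʳ k))

      at₂ : ∀ X → count (2 ℕ.+ k ℕ.* 3) X ≡ prefix₂ (+ k) X
      at₂ 0F = count-block′ k<m 2F 0F
      at₂ 1F = count-block′ k<m 2F 1F
      at₂ 2F = trans (count-block′ k<m 2F 2F) (cong +_ (ℕ.+-identityʳ k))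

      -- The end of block `k` is treated apart from the start of block `suc k`, since `suc k < m`
      -- fails for the last block.
      at₃ : ∀ X → count (3 ℕ.+ k ℕ.* 3) X ≡ prefix₃ (+ k) X
      at₃ X = trans (sum-cong-≗ {m} (λ i → shift (toℕ i))) (trans (∑-lt k<m) (cong +_ (ℕ.+-comm 1 k)))
        where
        shift : ∀ j → lt (j ℕ.* 3 ℕ.+ toℕ X) (suc k ℕ.* 3) ≡ lt j (suc k)
        shift j = trans (cong (lt (j ℕ.* 3 ℕ.+ toℕ X)) (sym (ℕ.+-identityʳ (suc k ℕ.* 3))))
          (trans (lt-block X 0F j (suc k)) (cong (lt j) (ℕ.+-identityʳ (suc k))))

  -- A single placement suffices: letting the three parts exchange roles in `sumPerms` stands for
  -- varying the order of the parts inside the blocks.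
  sumPerms-#sep-block : sumPerms #sep ≡ + m * + m * (+ m - 1ℤ) * (+ 2 * + m + 1ℤ)
  sumPerms-#sep-block = *-cancelˡ-≡ (+ 6) _ _ (begin
    + 6 * sumPerms #sep                ≡⟨ cong (+ 6 *_) sumPerms-#sep ⟩
    + 6 * (+ 2 * sumPerms #below)      ≡⟨ sym (*-assoc (+ 6) (+ 2) (sumPerms #below)) ⟩
    + 12 * sumPerms #below             ≡⟨ cong (+ 12 *_) (sumPerms-#below block<m*3) ⟩
    + 12 * psum (m ℕ.* 3) (λ n → totalGain (+ m) (count n) (count (suc n)))
      ≡⟨ telescope (+ 12) (λ k → Ψ (+ m) (const (+ k))) _ m (Ψ-start (+ m)) ΔΨ ⟩
    Ψ (+ m) (const (+ m))              ≡⟨ Ψ-end (+ m) ⟩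
    + 6 * (+ m * + m * (+ m - 1ℤ) * (+ 2 * + m + 1ℤ)) ∎)
    where
    open ≡-Reasoning
    G : ℕ → ℤ
    G n = totalGain (+ m) (count n) (count (suc n))
    ΔΨ : ∀ k → k ℕ.< m → Ψ (+ m) (const (+ suc k)) ≡
         Ψ (+ m) (const (+ k)) + + 12 * (G (k ℕ.* 3) + G (1 ℕ.+ k ℕ.* 3) + G (2 ℕ.+ k ℕ.* 3))
    ΔΨ k k<m = begin
      Ψ (+ m) (const (+ suc k))     ≡⟨ Ψ-cong (+ m) {const (+ suc k)} {const (+ k + 1ℤ)} (λ _ → cong +_ (ℕ.+-comm 1 k)) ⟩
      Ψ (+ m) (const (+ k + 1ℤ))    ≡⟨ ΔΨ-block (+ m) (+ k) ⟩
      Ψ (+ m) (const (+ k)) + + 12 * blockTotal (+ m) (+ k)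
        ≡⟨ cong (λ s → Ψ (+ m) (const (+ k)) + + 12 * s) (sym (cong₂ _+_ (cong₂ _+_
             (totalGain-cong (+ m) {c′ = count (1 ℕ.+ k ℕ.* 3)} (at₀ k<m) (at₁ k<m))
             (totalGain-cong (+ m) {c′ = count (2 ℕ.+ k ℕ.* 3)} (at₁ k<m) (at₂ k<m)))
             (totalGain-cong (+ m) {c′ = count (3 ℕ.+ k ℕ.* 3)} (at₂ k<m) (at₃ k<m)))) ⟩
      Ψ (+ m) (const (+ k)) + + 12 * (G (k ℕ.* 3) + G (1 ℕ.+ k ℕ.* 3) + G (2 ℕ.+ k ℕ.* 3)) ∎

  -- Out of m² (m - 1)² quadruples with distinct vertices in each part this is the fraction (m +
  -- 1)/(3m), just above (2m + 1)/(6m).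
  #sep-block-pair : ∀ X Y → X ≢ Y → + 3 * #sep X Y Y ≡ + m * (+ m + 1ℤ) * ((+ m - 1ℤ) * (+ m - 1ℤ))
  #sep-block-pair X Y X≢Y = begin
    + 3 * #sep X Y Y                       ≡⟨ cong (+ 3 *_) (#sep≡#below+#below X Y Y) ⟩
    + 3 * (#below X Y Y + #below X Y Y)    ≡⟨ solve 1 (λ b → con (+ 3) :* (b :+ b) := con (+ 6) :* b) refl (#below X Y Y) ⟩
    + 6 * #below X Y Y                     ≡⟨ cong (+ 6 *_) (#below-psum block<m*3 X Y Y) ⟩
    + 6 * psum (m ℕ.* 3) G                 ≡⟨ telescope (+ 6) (λ k → Φ (+ m) (+ k)) G m (Φ-start (+ m)) ΔΦ ⟩
    Φ (+ m) (+ m)                          ≡⟨ Φ-end (+ m) ⟩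
    + m * (+ m + 1ℤ) * ((+ m - 1ℤ) * (+ m - 1ℤ)) ∎
    where
    open ≡-Reasoning
    G : ℕ → ℤ
    G = stepGain X Y Y
    pairGain-cong : ∀ {c d c′ d′ : Fin 3 → ℤ} → (∀ X → c X ≡ d X) → (∀ X → c′ X ≡ d′ X) →
                    pairGain (+ m) c c′ X Y ≡ pairGain (+ m) d d′ X Y
    pairGain-cong c≗d c′≗d′ rewrite c≗d X | c≗d Y | c′≗d′ X | c′≗d′ Y = refl
    ΔΦ : ∀ k → k ℕ.< m → Φ (+ m) (+ suc k) ≡
         Φ (+ m) (+ k) + + 6 * (G (k ℕ.* 3) + G (1 ℕ.+ k ℕ.* 3) + G (2 ℕ.+ k ℕ.* 3))
    ΔΦ k k<m = begin
      Φ (+ m) (+ suc k)     ≡⟨ cong (Φ (+ m) ∘ +_) (ℕ.+-comm 1 k) ⟩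
      Φ (+ m) (+ k + 1ℤ)    ≡⟨ ΔΦ-block X Y X≢Y (+ m) (+ k) ⟩
      Φ (+ m) (+ k) + + 6 * blockPair X Y (+ m) (+ k)
        ≡⟨ cong (λ s → Φ (+ m) (+ k) + + 6 * s) (sym (cong₂ _+_ (cong₂ _+_
             (pairGain-cong {c′ = count (1 ℕ.+ k ℕ.* 3)} (at₀ k<m) (at₁ k<m))
             (pairGain-cong {c′ = count (2 ℕ.+ k ℕ.* 3)} (at₁ k<m) (at₂ k<m)))
             (pairGain-cong {c′ = count (3 ℕ.+ k ℕ.* 3)} (at₂ k<m) (at₃ k<m)))) ⟩
      Φ (+ m) (+ k) + + 6 * (G (k ℕ.* 3) + G (1 ℕ.+ k ℕ.* 3) + G (2 ℕ.+ k ℕ.* 3)) ∎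

-- Sums over lists

private variable
  A B : Set

∑ₗ : List A → (A → ℤ) → ℤ
∑ₗ []       f = 0ℤ
∑ₗ (x ∷ xs) f = f x + ∑ₗ xs f

∑ₗ-cong : ∀ (xs : List A) {f g : A → ℤ} → (∀ x → f x ≡ g x) → ∑ₗ xs f ≡ ∑ₗ xs g
∑ₗ-cong []       f≗g = refl
∑ₗ-cong (x ∷ xs) f≗g = cong₂ _+_ (f≗g x) (∑ₗ-cong xs f≗g)

∑ₗ-mono : ∀ (xs : List A) {f g : A → ℤ} → (∀ x → f x ≤ g x) → ∑ₗ xs f ≤ ∑ₗ xs g
∑ₗ-mono []       f≤g = ≤-refl
∑ₗ-mono (x ∷ xs) f≤g = +-mono-≤ (f≤g x) (∑ₗ-mono xs f≤g)

∑ₗ-const : ∀ (xs : List A) c → ∑ₗ xs (const c) ≡ + length xs * c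
∑ₗ-const []       c = refl
∑ₗ-const (x ∷ xs) c = trans (cong (λ y → c + y) (∑ₗ-const xs c)) (sym (suc-* (+ length xs) c))

∑ₗ-distrib-+ : ∀ (xs : List A) (f g : A → ℤ) → ∑ₗ xs (λ x → f x + g x) ≡ ∑ₗ xs f + ∑ₗ xs g
∑ₗ-distrib-+ []       f g = refl
∑ₗ-distrib-+ (x ∷ xs) f g = trans (cong (λ y → f x + g x + y) (∑ₗ-distrib-+ xs f g))
  (solve 4 (λ a b c d → a :+ b :+ (c :+ d) := a :+ c :+ (b :+ d)) refl (f x) (g x) _ _)

∑ₗ-*ˡ : ∀ (xs : List A) c (f : A → ℤ) → ∑ₗ xs (λ x → c * f x) ≡ c * ∑ₗ xs f
∑ₗ-*ˡ []       c f = sym (*-zeroʳ c)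
∑ₗ-*ˡ (x ∷ xs) c f = trans (cong (λ y → c * f x + y) (∑ₗ-*ˡ xs c f)) (sym (*-distribˡ-+ c (f x) _))

∑ₗ-zero : ∀ (xs : List A) → ∑ₗ xs (const 0ℤ) ≡ 0ℤ
∑ₗ-zero xs = trans (∑ₗ-const xs 0ℤ) (*-zeroʳ (+ length xs))

∑ₗ-comm : ∀ (xs : List A) (ys : List B) (f : A → B → ℤ) →
          ∑ₗ xs (λ x → ∑ₗ ys (f x)) ≡ ∑ₗ ys (λ y → ∑ₗ xs (λ x → f x y))
∑ₗ-comm []       ys f = sym (∑ₗ-zero ys)
∑ₗ-comm (x ∷ xs) ys f = trans (cong (λ s → ∑ₗ ys (f x) + s) (∑ₗ-comm xs ys f)) (sym (∑ₗ-distrib-+ ys (f x) _))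

∑-∑ₗ : ∀ {n} (xs : List A) (f : Fin n → A → ℤ) → ∑[ i < n ] ∑ₗ xs (f i) ≡ ∑ₗ xs (λ x → ∑[ i < n ] f i x)
∑-∑ₗ {n = n} []       f = sum-replicate-zero n
∑-∑ₗ {n = n} (x ∷ xs) f = trans (∑-distrib-+ (λ i → f i x) (λ i → ∑ₗ xs (f i))) (cong (λ s → ∑[ i < n ] f i x + s) (∑-∑ₗ xs f))

∑ₗ-++ : ∀ (xs ys : List A) (f : A → ℤ) → ∑ₗ (xs ++ ys) f ≡ ∑ₗ xs f + ∑ₗ ys f
∑ₗ-++ []       ys f = sym (+-identityˡ _)
∑ₗ-++ (x ∷ xs) ys f = trans (cong (λ s → f x + s) (∑ₗ-++ xs ys f)) (sym (+-assoc (f x) _ _))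

∑ₗ-map : ∀ (h : A → B) (xs : List A) (f : B → ℤ) → ∑ₗ (List.map h xs) f ≡ ∑ₗ xs (f ∘ h)
∑ₗ-map h []       f = refl
∑ₗ-map h (x ∷ xs) f = cong (λ s → f (h x) + s) (∑ₗ-map h xs f)

∑ₗ-concatMap : ∀ (h : A → List B) (xs : List A) (f : B → ℤ) → ∑ₗ (concatMap h xs) f ≡ ∑ₗ xs (λ x → ∑ₗ (h x) f)
∑ₗ-concatMap h []       f = refl
∑ₗ-concatMap h (x ∷ xs) f = trans (∑ₗ-++ (h x) (concatMap h xs) f) (cong (λ s → ∑ₗ (h x) f + s) (∑ₗ-concatMap h xs f))

∑ₗ-tabulate : ∀ {n} (h : Fin n → A) (f : A → ℤ) → ∑ₗ (List.tabulate h) f ≡ ∑[ i < n ] f (h i)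
∑ₗ-tabulate {n = zero}  h f = refl
∑ₗ-tabulate {n = suc n} h f = cong (λ s → f (h zero) + s) (∑ₗ-tabulate (h ∘ suc) f)

length-∑ₗ : ∀ (xs : List A) → + length xs ≡ ∑ₗ xs (const 1ℤ)
length-∑ₗ xs = sym (trans (∑ₗ-const xs 1ℤ) (*-identityʳ _))

length-filter-∑ₗ : ∀ {P : A → Set} (P? : ∀ x → Dec (P x)) xs → + length (filter P? xs) ≡ ∑ₗ xs (𝟙 ∘ P?)
length-filter-∑ₗ P? []       = refl
length-filter-∑ₗ P? (x ∷ xs) with does (P? x)
... | true  = cong (λ s → 1ℤ + s) (length-filter-∑ₗ P? xs)
... | false = trans (length-filter-∑ₗ P? xs) (sym (+-identityˡ _))

∑ₗ-concat-replicate : ∀ n (xs : List A) f → ∑ₗ (concat (replicate n xs)) f ≡ + n * ∑ₗ xs f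
∑ₗ-concat-replicate zero    xs f = refl
∑ₗ-concat-replicate (suc n) xs f = trans (∑ₗ-++ xs _ f)
  (trans (cong (λ s → ∑ₗ xs f + s) (∑ₗ-concat-replicate n xs f)) (sym (suc-* (+ n) _)))

-- Averaging over all permutations

open Injection using (to; injective)

-- The value at 0 is `k`, and the rest is a smaller permutation into the complement of `k`. Summing
-- over that first value is the induction behind all the averages.
insertFirst : ∀ {m} → Fin (suc m) → Fin m ↣ Fin m → Fin (suc m) ↣ Fin (suc m)
insertFirst {m} k π = mk↣ {to = f} f-injective
  where
  f : Fin (suc m) → Fin (suc m)
  f zero    = k
  f (suc i) = punchIn k (to π i)
  f-injective : ∀ {i j} → f i ≡ f j → i ≡ j
  f-injective {zero}  {zero}  eq = refl
  f-injective {zero}  {suc j} eq = contradiction (sym eq) (Fin.punchInᵢ≢i k _)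
  f-injective {suc i} {zero}  eq = contradiction eq (Fin.punchInᵢ≢i k _)
  f-injective {suc i} {suc j} eq = cong suc (injective π (Fin.punchIn-injective k _ _ eq))

perms : ∀ m → List (Fin m ↣ Fin m)
perms zero    = mk↣ {to = id} id ∷ []
perms (suc m) = concatMap (λ k → List.map (insertFirst k) (perms m)) (allFin (suc m))

∑ₗ-perms : ∀ m F → ∑ₗ (perms (suc m)) F ≡ ∑[ k ≤ m ] ∑ₗ (perms m) (F ∘ insertFirst k)
∑ₗ-perms m F = begin
  ∑ₗ (perms (suc m)) F
    ≡⟨ ∑ₗ-concatMap (λ k → List.map (insertFirst k) (perms m)) (allFin (suc m)) F ⟩
  ∑ₗ (allFin (suc m)) (λ k → ∑ₗ (List.map (insertFirst k) (perms m)) F)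
    ≡⟨ ∑ₗ-tabulate id (λ k → ∑ₗ (List.map (insertFirst k) (perms m)) F) ⟩
  ∑[ k ≤ m ] ∑ₗ (List.map (insertFirst k) (perms m)) F
    ≡⟨ sum-cong-≗ (λ k → ∑ₗ-map (insertFirst k) (perms m) F) ⟩
  ∑[ k ≤ m ] ∑ₗ (perms m) (F ∘ insertFirst k) ∎
  where open ≡-Reasoning

suc-!-* : ∀ m x → + suc m * (+ (m !) * x) ≡ + (suc m !) * x
suc-!-* m x = trans (sym (*-assoc (+ suc m) (+ (m !)) x)) (cong (_* x) (sym (pos-* (suc m) (m !))))

∑-const-perms : ∀ m c → ∑ₗ (perms m) (const c) ≡ + (m !) * c
∑-const-perms zero    c = trans (+-identityʳ c) (sym (*-identityˡ c))
∑-const-perms (suc m) c = begin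
  ∑ₗ (perms (suc m)) (const c)               ≡⟨ ∑ₗ-perms m (const c) ⟩
  ∑[ k ≤ m ] ∑ₗ (perms m) (const c)          ≡⟨ sum-cong-≗ (λ (_ : Fin (suc m)) → ∑-const-perms m c) ⟩
  ∑[ k ≤ m ] (+ (m !) * c)                   ≡⟨ sum-replicate-* (suc m) _ ⟩
  + suc m * (+ (m !) * c)                    ≡⟨ suc-!-* m c ⟩
  + (suc m !) * c                            ∎
  where open ≡-Reasoning

-- Exactly m! permutations take a given value at `a`. In the inductive step a value survives the
-- removal of the first value `k` for all choices of `k` but one.
average₁ : ∀ m (a : Fin (suc m)) (f : Fin (suc m) → ℤ) →
           ∑ₗ (perms (suc m)) (λ π → f (to π a)) ≡ + (m !) * sum f
average₁ m zero f = begin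
  ∑ₗ (perms (suc m)) (λ π → f (to π zero))   ≡⟨ ∑ₗ-perms m _ ⟩
  ∑[ k ≤ m ] ∑ₗ (perms m) (const (f k))      ≡⟨ sum-cong-≗ (λ k → ∑-const-perms m (f k)) ⟩
  ∑[ k ≤ m ] (+ (m !) * f k)                 ≡⟨ sym (*-distribˡ-sum (+ (m !)) f) ⟩
  + (m !) * sum f                            ∎
  where open ≡-Reasoning
average₁ (suc m) (suc a) f = begin
  ∑ₗ (perms (2 ℕ.+ m)) (λ π → f (to π (suc a)))
    ≡⟨ ∑ₗ-perms (suc m) _ ⟩
  ∑[ k ≤ suc m ] ∑ₗ (perms (suc m)) (λ π → f (punchIn k (to π a)))
    ≡⟨ sum-cong-≗ (λ k → average₁ m a (f ∘ punchIn k)) ⟩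
  ∑[ k ≤ suc m ] (+ (m !) * sum (f ∘ punchIn k))
    ≡⟨ sym (*-distribˡ-sum (+ (m !)) (λ k → sum (f ∘ punchIn k))) ⟩
  + (m !) * ∑[ k ≤ suc m ] sum (f ∘ punchIn k)
    ≡⟨ cong (+ (m !) *_) (sum-cong-≗ λ k → ∑-punchIn k f) ⟩
  + (m !) * ∑[ k ≤ suc m ] (sum f - f k)
    ≡⟨ cong (+ (m !) *_) (trans (∑-distrib-- (const (sum f)) f) (cong (_- sum f) (sum-replicate-* (2 ℕ.+ m) (sum f)))) ⟩
  + (m !) * (+ (2 ℕ.+ m) * sum f - sum f)
    ≡⟨ solve 3 (λ F n s → F :* ((con 1ℤ :+ n) :* s :- s) := n :* (F :* s)) refl (+ (m !)) (+ suc m) (sum f) ⟩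
  + suc m * (+ (m !) * sum f)
    ≡⟨ suc-!-* m (sum f) ⟩
  + (suc m !) * sum f ∎
  where open ≡-Reasoning

-- Exactly m! permutations take two given distinct values at `a` and `b`. The zero diagonal lets the
-- sum run over equal values too.
average₂ : ∀ m (a b : Fin (2 ℕ.+ m)) → a ≢ b → (f : Fin (2 ℕ.+ m) → Fin (2 ℕ.+ m) → ℤ) → (∀ i → f i i ≡ 0ℤ) →
  ∑ₗ (perms (2 ℕ.+ m)) (λ π → f (to π a) (to π b)) ≡ + (m !) * ∑[ i ≤ suc m ] ∑[ j ≤ suc m ] f i j
average₂ m zero zero a≢b f f-diag = contradiction refl a≢b
average₂ m zero (suc b) a≢b f f-diag = begin
  ∑ₗ (perms (2 ℕ.+ m)) (λ π → f (to π zero) (to π (suc b)))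
    ≡⟨ ∑ₗ-perms (suc m) _ ⟩
  ∑[ k ≤ suc m ] ∑ₗ (perms (suc m)) (λ π → f k (punchIn k (to π b)))
    ≡⟨ sum-cong-≗ (λ k → average₁ m b (f k ∘ punchIn k)) ⟩
  ∑[ k ≤ suc m ] (+ (m !) * sum (f k ∘ punchIn k))
    ≡⟨ sym (*-distribˡ-sum (+ (m !)) (λ k → sum (f k ∘ punchIn k))) ⟩
  + (m !) * ∑[ k ≤ suc m ] sum (f k ∘ punchIn k)
    ≡⟨ cong (+ (m !) *_) (sum-cong-≗ λ k → trans (∑-punchIn k (f k))
         (trans (cong (λ z → sum (f k) - z) (f-diag k)) (+-identityʳ (sum (f k))))) ⟩
  + (m !) * ∑[ i ≤ suc m ] ∑[ j ≤ suc m ] f i j ∎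
  where open ≡-Reasoning
average₂ m (suc a) zero a≢b f f-diag =
  trans (average₂ m zero (suc a) (λ ()) (λ i j → f j i) f-diag) (cong (+ (m !) *_) (∑-comm λ i j → f j i))
average₂ zero (suc zero) (suc zero) a≢b f f-diag = contradiction refl a≢b
average₂ (suc m) (suc a) (suc b) a≢b f f-diag = begin
  ∑ₗ (perms (3 ℕ.+ m)) (λ π → f (to π (suc a)) (to π (suc b)))
    ≡⟨ ∑ₗ-perms (2 ℕ.+ m) _ ⟩
  ∑[ k ≤ 2 ℕ.+ m ] ∑ₗ (perms (2 ℕ.+ m)) (λ π → f (punchIn k (to π a)) (punchIn k (to π b)))
    ≡⟨ sum-cong-≗ (λ k → average₂ m a b (a≢b ∘ cong suc) (λ i j → f (punchIn k i) (punchIn k j)) (λ i → f-diag (punchIn k i))) ⟩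
  ∑[ k ≤ 2 ℕ.+ m ] (+ (m !) * rest k)
    ≡⟨ sym (*-distribˡ-sum (+ (m !)) rest) ⟩
  + (m !) * sum rest
    ≡⟨ cong (+ (m !) *_) (sum-cong-≗ rest≡) ⟩
  + (m !) * ∑[ k ≤ 2 ℕ.+ m ] (T - col k - row k)
    ≡⟨ cong (+ (m !) *_) (trans (∑-distrib-- (λ k → T - col k) row) (cong (_- T) (∑-distrib-- (const T) col))) ⟩
  + (m !) * (∑[ k ≤ 2 ℕ.+ m ] T - sum col - T)
    ≡⟨ cong₂ (λ x y → + (m !) * (x - y - T)) (sum-replicate-* (3 ℕ.+ m) T) (∑-comm λ k i → f i k) ⟩
  + (m !) * (+ (3 ℕ.+ m) * T - T - T)
    ≡⟨ solve 3 (λ F n s → F :* ((con (+ 2) :+ n) :* s :- s :- s) := n :* (F :* s)) refl (+ (m !)) (+ suc m) T ⟩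
  + suc m * (+ (m !) * T)
    ≡⟨ suc-!-* m T ⟩
  + (suc m !) * T ∎
  where
  open ≡-Reasoning
  row col rest : Fin (3 ℕ.+ m) → ℤ
  row k = ∑[ j ≤ 2 ℕ.+ m ] f k j
  col k = ∑[ i ≤ 2 ℕ.+ m ] f i k
  rest k = ∑[ i ≤ suc m ] ∑[ j ≤ suc m ] f (punchIn k i) (punchIn k j)
  T = ∑[ i ≤ 2 ℕ.+ m ] ∑[ j ≤ 2 ℕ.+ m ] f i j
  -- The corner `f k k` is subtracted with the row and again with the column, harmlessly because it
  -- is zero.
  rest≡ : ∀ k → rest k ≡ T - col k - row k
  rest≡ k = begin
    rest k                                            ≡⟨ sum-cong-≗ (λ i → ∑-punchIn k (f (punchIn k i))) ⟩
    ∑[ i ≤ suc m ] (row (punchIn k i) - f (punchIn k i) k)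
      ≡⟨ ∑-punchIn k (λ i → row i - f i k) ⟩
    ∑[ i ≤ 2 ℕ.+ m ] (row i - f i k) - (row k - f k k)
      ≡⟨ cong₂ (λ x y → x - (row k - y)) (∑-distrib-- row (λ i → f i k)) (f-diag k) ⟩
    T - col k - (row k - 0ℤ)                          ≡⟨ cong (λ x → T - col k - x) (+-identityʳ (row k)) ⟩
    T - col k - row k                                 ∎

-- The optimal family of orderings

-- Matching on the six cases makes all three parts concrete, so that the finite rearrangements below
-- can be computed.
data IsPerm : (X Y Z : Fin 3) → Set where
  p012 : IsPerm 0F 1F 2F
  p021 : IsPerm 0F 2F 1F
  p102 : IsPerm 1F 0F 2F
  p120 : IsPerm 1F 2F 0F
  p201 : IsPerm 2F 0F 1F
  p210 : IsPerm 2F 1F 0F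

third : ∀ {X Y} → X ≢ Y → ∃ (IsPerm X Y)
third {0F} {0F} X≢Y = contradiction refl X≢Y
third {0F} {1F} X≢Y = 2F , p012
third {0F} {2F} X≢Y = 1F , p021
third {1F} {0F} X≢Y = 2F , p102
third {1F} {1F} X≢Y = contradiction refl X≢Y
third {1F} {2F} X≢Y = 0F , p120
third {2F} {0F} X≢Y = 1F , p201
third {2F} {1F} X≢Y = 0F , p210
third {2F} {2F} X≢Y = contradiction refl X≢Y

noFourth : ∀ {X Y Z} → IsPerm X Y Z → ∀ {W} → X ≢ W → Y ≢ W → Z ≡ W
noFourth p012 {0F} X≢W Y≢W = contradiction refl X≢W
noFourth p012 {1F} X≢W Y≢W = contradiction refl Y≢W
noFourth p012 {2F} X≢W Y≢W = refl
noFourth p021 {0F} X≢W Y≢W = contradiction refl X≢W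
noFourth p021 {1F} X≢W Y≢W = refl
noFourth p021 {2F} X≢W Y≢W = contradiction refl Y≢W
noFourth p102 {0F} X≢W Y≢W = contradiction refl Y≢W
noFourth p102 {1F} X≢W Y≢W = contradiction refl X≢W
noFourth p102 {2F} X≢W Y≢W = refl
noFourth p120 {0F} X≢W Y≢W = refl
noFourth p120 {1F} X≢W Y≢W = contradiction refl X≢W
noFourth p120 {2F} X≢W Y≢W = contradiction refl Y≢W
noFourth p201 {0F} X≢W Y≢W = contradiction refl Y≢W
noFourth p201 {1F} X≢W Y≢W = refl
noFourth p201 {2F} X≢W Y≢W = contradiction refl X≢W
noFourth p210 {0F} X≢W Y≢W = refl
noFourth p210 {1F} X≢W Y≢W = contradiction refl Y≢W
noFourth p210 {2F} X≢W Y≢W = contradiction refl X≢W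

distinct⇒IsPerm : ∀ {X Y Z} → X ≢ Y → X ≢ Z → Y ≢ Z → IsPerm X Y Z
distinct⇒IsPerm {X} {Y} X≢Y X≢Z Y≢Z with third X≢Y
... | W , perm = subst (IsPerm X Y) (noFourth perm X≢Z Y≢Z) perm

IsPerm⇒≢ : ∀ {X Y Z} → IsPerm X Y Z → X ≢ Y × X ≢ Z × Y ≢ Z
IsPerm⇒≢ p012 = (λ ()) , (λ ()) , (λ ())
IsPerm⇒≢ p021 = (λ ()) , (λ ()) , (λ ())
IsPerm⇒≢ p102 = (λ ()) , (λ ()) , (λ ())
IsPerm⇒≢ p120 = (λ ()) , (λ ()) , (λ ())
IsPerm⇒≢ p201 = (λ ()) , (λ ()) , (λ ())
IsPerm⇒≢ p210 = (λ ()) , (λ ()) , (λ ())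

-- Composing with a fixed relabelling permutes the six summands; each `list` records the order that
-- results.
∑ₗ-perms₃ : ∀ {X Y Z} → IsPerm X Y Z → (h : Fin 3 → Fin 3 → Fin 3 → ℤ) →
            ∑ₗ (perms 3) (λ s → h (to s X) (to s Y) (to s Z)) ≡ sumPerms h
∑ₗ-perms₃ {X} {Y} {Z} perm h = rearrange perm
  where
  rearrange : IsPerm X Y Z → ∑ₗ (perms 3) (λ s → h (to s X) (to s Y) (to s Z)) ≡ sumPerms h
  a = h 0F 1F 2F
  b = h 0F 2F 1F
  c = h 1F 0F 2F
  d = h 1F 2F 0F
  e = h 2F 0F 1F
  f = h 2F 1F 0F
  list : ∀ {n} → (a b c d e f : Polynomial n) → Polynomial n
  list a b c d e f = a :+ (b :+ (c :+ (d :+ (e :+ (f :+ con 0ℤ)))))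
  total : ∀ {n} → (a b c d e f : Polynomial n) → Polynomial n
  total a b c d e f = a :+ b :+ c :+ d :+ e :+ f
  rearrange p012 = solve 6 (λ a b c d e f → list a b c d e f := total a b c d e f) refl a b c d e f
  rearrange p021 = solve 6 (λ a b c d e f → list b a d c f e := total a b c d e f) refl a b c d e f
  rearrange p102 = solve 6 (λ a b c d e f → list c e a f b d := total a b c d e f) refl a b c d e f
  rearrange p120 = solve 6 (λ a b c d e f → list d f b e a c := total a b c d e f) refl a b c d e f
  rearrange p201 = solve 6 (λ a b c d e f → list e c f a d b := total a b c d e f) refl a b c d e f
  rearrange p210 = solve 6 (λ a b c d e f → list f d e b c a := total a b c d e f) refl a b c d e f

select : ∀ {A : Set} → A → A → A → Fin 3 → A
select a b c 0F = a
select a b c 1F = b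
select a b c 2F = c

module _ {A : Set} (xs : List A) where
  ∑₃ : (A → A → A → ℤ) → ℤ
  ∑₃ G = ∑ₗ xs λ a → ∑ₗ xs λ b → ∑ₗ xs λ c → G a b c

  ∑₃-swapʳ : ∀ H → ∑₃ H ≡ ∑₃ (λ a c b → H a b c)
  ∑₃-swapʳ H = ∑ₗ-cong xs λ a → ∑ₗ-comm xs xs (H a)

  ∑₃-swapˡ : ∀ H → ∑₃ H ≡ ∑₃ (λ b a c → H a b c)
  ∑₃-swapˡ H = ∑ₗ-comm xs xs λ a b → ∑ₗ xs (H a b)

  -- The three sums are independent, so they may be exchanged until each variable is named by the
  -- role of its part instead of its index.
  ∑₃-select : ∀ {X Y Z} → IsPerm X Y Z → (G : A → A → A → ℤ) →
    ∑₃ (λ a b c → G (select a b c X) (select a b c Y) (select a b c Z)) ≡ ∑₃ G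
  ∑₃-select p012 G = refl
  ∑₃-select p021 G = ∑₃-swapʳ λ a b c → G a c b
  ∑₃-select p102 G = ∑₃-swapˡ λ a b c → G b a c
  ∑₃-select p120 G = trans (∑₃-swapˡ λ a b c → G b c a) (∑₃-swapʳ λ b a c → G b c a)
  ∑₃-select p201 G = trans (∑₃-swapʳ λ a b c → G c a b) (∑₃-swapˡ λ a c b → G c a b)
  ∑₃-select p210 G = trans (∑₃-swapʳ λ a b c → G c b a) (trans (∑₃-swapˡ λ a c b → G c b a) (∑₃-swapʳ λ c a b → G c b a))

∑ₗ-*ˡ³ : ∀ {A : Set} (xs : List A) a b c (f : A → ℤ) → ∑ₗ xs (λ x → a * (b * (c * f x))) ≡ a * (b * (c * ∑ₗ xs f))
∑ₗ-*ˡ³ xs a b c f = trans (∑ₗ-*ˡ xs a λ x → b * (c * f x))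
  (cong (a *_) (trans (∑ₗ-*ˡ xs b λ x → c * f x) (cong (b *_) (∑ₗ-*ˡ xs c f))))

blockOrdering : ∀ {m} → Fin 3 ↣ Fin 3 → (π₀ π₁ π₂ : Fin m ↣ Fin m) → LinearOrdering m
blockOrdering {m} s π₀ π₁ π₂ = record
  { pos = λ (X , x) → block (to s X) (to (select π₀ π₁ π₂ X) x)
  ; inj = pos-injective
  }
  where
  pos-injective : ∀ {u v : Vertex m} →
    block (to s (proj₁ u)) (to (select π₀ π₁ π₂ (proj₁ u)) (proj₂ u)) ≡
    block (to s (proj₁ v)) (to (select π₀ π₁ π₂ (proj₁ v)) (proj₂ v)) → u ≡ v
  pos-injective {X , x} {Y , y} eq with block-injective {m} {to s X} {to s Y} {to (select π₀ π₁ π₂ X) x} {to (select π₀ π₁ π₂ Y) y} eq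
  ... | πx≡πy , sX≡sY with injective s sX≡sY
  ...   | refl = cong (X ,_) (injective (select π₀ π₁ π₂ X) πx≡πy)

module _ (m : ℕ) where
  private
    withFirst : Fin 3 ↣ Fin 3 → Fin m ↣ Fin m → Fin m ↣ Fin m → List (LinearOrdering m)
    withFirst s π₀ π₁ = List.map (blockOrdering s π₀ π₁) (perms m)

    withPattern : Fin 3 ↣ Fin 3 → List (LinearOrdering m)
    withPattern s = concatMap (λ π₀ → concatMap (withFirst s π₀) (perms m)) (perms m)

  orderings : List (LinearOrdering m)
  orderings = concatMap withPattern (perms 3)

  ∑ₗ-orderings : ∀ F → ∑ₗ orderings F ≡ ∑ₗ (perms 3) λ s → ∑₃ (perms m) λ π₀ π₁ π₂ → F (blockOrdering s π₀ π₁ π₂)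
  ∑ₗ-orderings F =
    trans (∑ₗ-concatMap withPattern (perms 3) F) (∑ₗ-cong (perms 3) λ s →
    trans (∑ₗ-concatMap (λ π₀ → concatMap (withFirst s π₀) (perms m)) (perms m) F) (∑ₗ-cong (perms m) λ π₀ →
    trans (∑ₗ-concatMap (withFirst s π₀) (perms m) F) (∑ₗ-cong (perms m) λ π₁ →
    ∑ₗ-map (blockOrdering s π₀ π₁) (perms m) F)))

-- Averages of separation counts over the family

module _ (n : ℕ) where
  private
    m = 2 ℕ.+ n
    K₀ K₁ K₂ : ℤ
    K₀ = + (m !)
    K₁ = + (suc n !)
    K₂ = + (n !)

  -- Two prescribed values leave (m - 2)! permutations for the shared part, and one prescribed value
  -- leaves (m - 1)! for each of the other two.
  average₂₁₁ : ∀ {a₁ a₂ : Fin m} → a₁ ≢ a₂ → ∀ b c (F : Fin m → Fin m → Fin m → Fin m → ℤ) →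
    (∀ i k l → F i i k l ≡ 0ℤ) →
    ∑₃ (perms m) (λ π π′ π″ → F (to π a₁) (to π a₂) (to π′ b) (to π″ c)) ≡ K₁ * (K₁ * (K₂ * ∑₄ m F))
  average₂₁₁ {a₁} {a₂} a₁≢a₂ b c F F-diag = begin
    ∑₃ (perms m) (λ π π′ π″ → F (to π a₁) (to π a₂) (to π′ b) (to π″ c))
      ≡⟨ (∑ₗ-cong (perms m) λ π → ∑ₗ-cong (perms m) λ π′ → average₁ (suc n) c (F (to π a₁) (to π a₂) (to π′ b))) ⟩
    ∑ₗ (perms m) (λ π → ∑ₗ (perms m) λ π′ → K₁ * sum (F (to π a₁) (to π a₂) (to π′ b)))
      ≡⟨ (∑ₗ-cong (perms m) λ π → trans (∑ₗ-*ˡ (perms m) K₁ _)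
           (cong (K₁ *_) (average₁ (suc n) b λ k → sum (F (to π a₁) (to π a₂) k)))) ⟩
    ∑ₗ (perms m) (λ π → K₁ * (K₁ * g (to π a₁) (to π a₂)))
      ≡⟨ trans (∑ₗ-*ˡ (perms m) K₁ _) (cong (K₁ *_) (∑ₗ-*ˡ (perms m) K₁ _)) ⟩
    K₁ * (K₁ * ∑ₗ (perms m) (λ π → g (to π a₁) (to π a₂)))
      ≡⟨ cong (λ x → K₁ * (K₁ * x)) (average₂ n a₁ a₂ a₁≢a₂ g g-diag) ⟩
    K₁ * (K₁ * (K₂ * ∑₄ m F)) ∎
    where
    open ≡-Reasoning
    g : Fin m → Fin m → ℤ
    g i j = ∑[ k < m ] ∑[ l < m ] F i j k l
    g-diag : ∀ i → g i i ≡ 0ℤ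
    g-diag i = trans (∑∑-cong (F-diag i)) (trans (sum-cong-≗ {m} λ _ → sum-replicate-zero m) (sum-replicate-zero m))

  -- The third part contains no vertex of the pair; its permutation is free and contributes m!.
  average₂₂ : ∀ {a₁ a₂ b₁ b₂ : Fin m} → a₁ ≢ a₂ → b₁ ≢ b₂ → (F : Fin m → Fin m → Fin m → Fin m → ℤ) →
    (∀ i k l → F i i k l ≡ 0ℤ) → (∀ i j k → F i j k k ≡ 0ℤ) →
    ∑₃ (perms m) (λ π π′ _ → F (to π a₁) (to π a₂) (to π′ b₁) (to π′ b₂)) ≡ K₀ * (K₂ * (K₂ * ∑₄ m F))
  average₂₂ {a₁} {a₂} {b₁} {b₂} a₁≢a₂ b₁≢b₂ F F-diag₁ F-diag₂ = begin
    ∑₃ (perms m) (λ π π′ _ → F (to π a₁) (to π a₂) (to π′ b₁) (to π′ b₂))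
      ≡⟨ (∑ₗ-cong (perms m) λ π → ∑ₗ-cong (perms m) λ π′ → ∑-const-perms m _) ⟩
    ∑ₗ (perms m) (λ π → ∑ₗ (perms m) λ π′ → K₀ * F (to π a₁) (to π a₂) (to π′ b₁) (to π′ b₂))
      ≡⟨ (∑ₗ-cong (perms m) λ π → trans (∑ₗ-*ˡ (perms m) K₀ _)
           (cong (K₀ *_) (average₂ n b₁ b₂ b₁≢b₂ (F (to π a₁) (to π a₂)) (F-diag₂ (to π a₁) (to π a₂))))) ⟩
    ∑ₗ (perms m) (λ π → K₀ * (K₂ * g (to π a₁) (to π a₂)))
      ≡⟨ trans (∑ₗ-*ˡ (perms m) K₀ _) (cong (K₀ *_) (∑ₗ-*ˡ (perms m) K₂ _)) ⟩
    K₀ * (K₂ * ∑ₗ (perms m) (λ π → g (to π a₁) (to π a₂)))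
      ≡⟨ cong (λ x → K₀ * (K₂ * x)) (average₂ n a₁ a₂ a₁≢a₂ g g-diag) ⟩
    K₀ * (K₂ * (K₂ * ∑₄ m F)) ∎
    where
    open ≡-Reasoning
    g : Fin m → Fin m → ℤ
    g i j = ∑[ k < m ] ∑[ l < m ] F i j k l
    g-diag : ∀ i → g i i ≡ 0ℤ
    g-diag i = trans (∑∑-cong (F-diag₁ i)) (trans (sum-cong-≗ {m} λ _ → sum-replicate-zero m) (sum-replicate-zero m))

  open BlockPlacement m using (#sep; sumPerms-#sep-block; #sep-block-pair)

  sepSum : (u v u′ v′ : Vertex m) → ℤ
  sepSum u v u′ v′ = ∑ₗ (orderings m) λ σ → sep (pos σ u) (pos σ v) (pos σ u′) (pos σ v′)

  sepSum₂₁₁ : ∀ {X Y Z} → IsPerm X Y Z → ∀ {a₁ a₂} → a₁ ≢ a₂ → ∀ b c →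
    sepSum (X , a₁) (Y , b) (X , a₂) (Z , c) ≡ K₁ * (K₁ * (K₂ * (+ m * + m * (+ m - 1ℤ) * (+ 2 * + m + 1ℤ))))
  sepSum₂₁₁ {X} {Y} {Z} perm {a₁} {a₂} a₁≢a₂ b c = begin
    sepSum (X , a₁) (Y , b) (X , a₂) (Z , c)
      ≡⟨ ∑ₗ-orderings m (λ σ → sep (pos σ (X , a₁)) (pos σ (Y , b)) (pos σ (X , a₂)) (pos σ (Z , c))) ⟩
    ∑ₗ (perms 3) (λ s → ∑₃ (perms m) λ π₀ π₁ π₂ → let Π = select π₀ π₁ π₂ in
      F s (to (Π X) a₁) (to (Π X) a₂) (to (Π Y) b) (to (Π Z) c))
      ≡⟨ (∑ₗ-cong (perms 3) λ s → trans
           (∑₃-select (perms m) perm λ π π′ π″ → F s (to π a₁) (to π a₂) (to π′ b) (to π″ c))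
           (average₂₁₁ a₁≢a₂ b c (F s) λ i k l → sep-irrefl₁ (block (to s X) i) (block (to s Y) k) (block (to s Z) l))) ⟩
    ∑ₗ (perms 3) (λ s → K₁ * (K₁ * (K₂ * #sep (to s X) (to s Y) (to s Z))))
      ≡⟨ ∑ₗ-*ˡ³ (perms 3) K₁ K₁ K₂ (λ s → #sep (to s X) (to s Y) (to s Z)) ⟩
    K₁ * (K₁ * (K₂ * ∑ₗ (perms 3) (λ s → #sep (to s X) (to s Y) (to s Z))))
      ≡⟨ cong (λ x → K₁ * (K₁ * (K₂ * x))) (trans (∑ₗ-perms₃ perm #sep) sumPerms-#sep-block) ⟩
    K₁ * (K₁ * (K₂ * (+ m * + m * (+ m - 1ℤ) * (+ 2 * + m + 1ℤ)))) ∎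
    where
    open ≡-Reasoning
    F : Fin 3 ↣ Fin 3 → Fin m → Fin m → Fin m → Fin m → ℤ
    F s i j k l = sep (block (to s X) i) (block (to s Y) k) (block (to s X) j) (block (to s Z) l)

  -- All six patterns contribute equally, whence the 6; the 3 is the denominator in
  -- `#sep-block-pair`.
  sepSum₂₂ : ∀ {X Y} → X ≢ Y → ∀ {a₁ a₂ b₁ b₂} → a₁ ≢ a₂ → b₁ ≢ b₂ →
    + 3 * sepSum (X , a₁) (Y , b₁) (X , a₂) (Y , b₂) ≡
    + 6 * (K₀ * (K₂ * (K₂ * (+ m * (+ m + 1ℤ) * ((+ m - 1ℤ) * (+ m - 1ℤ))))))
  sepSum₂₂ {X} {Y} X≢Y {a₁} {a₂} {b₁} {b₂} a₁≢a₂ b₁≢b₂ = begin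
    + 3 * sepSum (X , a₁) (Y , b₁) (X , a₂) (Y , b₂)
      ≡⟨ cong (+ 3 *_) (∑ₗ-orderings m λ σ → sep (pos σ (X , a₁)) (pos σ (Y , b₁)) (pos σ (X , a₂)) (pos σ (Y , b₂))) ⟩
    + 3 * ∑ₗ (perms 3) (λ s → ∑₃ (perms m) λ π₀ π₁ π₂ → let Π = select π₀ π₁ π₂ in
      F s (to (Π X) a₁) (to (Π X) a₂) (to (Π Y) b₁) (to (Π Y) b₂))
      ≡⟨ cong (+ 3 *_) (∑ₗ-cong (perms 3) λ s → trans
           (∑₃-select (perms m) (proj₂ (third X≢Y)) λ π π′ _ → F s (to π a₁) (to π a₂) (to π′ b₁) (to π′ b₂))
           (average₂₂ a₁≢a₂ b₁≢b₂ (F s) (λ i k l → sep-irrefl₁ (block (to s X) i) (block (to s Y) k) (block (to s Y) l))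
                                        (λ i j k → sep-irrefl₂ (block (to s X) i) (block (to s Y) k) (block (to s X) j)))) ⟩
    + 3 * ∑ₗ (perms 3) (λ s → K₀ * (K₂ * (K₂ * #sep (to s X) (to s Y) (to s Y))))
      ≡⟨ sym (∑ₗ-*ˡ (perms 3) (+ 3) λ s → K₀ * (K₂ * (K₂ * #sep (to s X) (to s Y) (to s Y)))) ⟩
    ∑ₗ (perms 3) (λ s → + 3 * (K₀ * (K₂ * (K₂ * #sep (to s X) (to s Y) (to s Y)))))
      ≡⟨ (∑ₗ-cong (perms 3) λ s → trans
           (solve 3 (λ k₀ k₂ x → con (+ 3) :* (k₀ :* (k₂ :* (k₂ :* x))) := k₀ :* (k₂ :* (k₂ :* (con (+ 3) :* x)))) refl K₀ K₂
             (#sep (to s X) (to s Y) (to s Y)))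
           (cong (λ x → K₀ * (K₂ * (K₂ * x))) (#sep-block-pair (to s X) (to s Y) (X≢Y ∘ injective s)))) ⟩
    ∑ₗ (perms 3) (const (K₀ * (K₂ * (K₂ * (+ m * (+ m + 1ℤ) * ((+ m - 1ℤ) * (+ m - 1ℤ)))))))
      ≡⟨ ∑-const-perms 3 (K₀ * (K₂ * (K₂ * (+ m * (+ m + 1ℤ) * ((+ m - 1ℤ) * (+ m - 1ℤ)))))) ⟩
    + 6 * (K₀ * (K₂ * (K₂ * (+ m * (+ m + 1ℤ) * ((+ m - 1ℤ) * (+ m - 1ℤ)))))) ∎
    where
    open ≡-Reasoning
    F : Fin 3 ↣ Fin 3 → Fin m → Fin m → Fin m → Fin m → ℤ
    F s i j k l = sep (block (to s X) i) (block (to s Y) k) (block (to s X) j) (block (to s Y) l)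

-- Separation of all nonincident pairs by the family

separates-sum : ∀ {m} (L : List (LinearOrdering m)) e f → + sepCount L e f ≡
  ∑ₗ L λ σ → sep (pos σ (end₁ e)) (pos σ (end₂ e)) (pos σ (end₁ f)) (pos σ (end₂ f))
separates-sum L e f = length-filter-∑ₗ (λ σ → separates? σ e f) L

module _ (n : ℕ) where
  private
    m = 2 ℕ.+ n

  -- How often the family separates each pair sharing exactly one part, the value in `sepSum₂₁₁`;
  -- `suc n` stands for m - 1 to stay within the naturals.
  multiplicity : ℕ
  multiplicity = suc n ! ℕ.* (suc n ! ℕ.* (n ! ℕ.* (m ℕ.* m ℕ.* suc n ℕ.* (2 ℕ.* m ℕ.+ 1))))

  multiplicity-ℤ : + multiplicity ≡
    + (suc n !) * (+ (suc n !) * (+ (n !) * (+ m * + m * (+ m - 1ℤ) * (+ 2 * + m + 1ℤ))))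
  multiplicity-ℤ =
    trans (pos-* (suc n !) _) (cong (+ (suc n !) *_) (
    trans (pos-* (suc n !) _) (cong (+ (suc n !) *_) (
    trans (pos-* (n !) _) (cong (+ (n !) *_) (
    trans (pos-* (m ℕ.* m ℕ.* suc n) (2 ℕ.* m ℕ.+ 1))
          (cong₂ _*_ (trans (pos-* (m ℕ.* m) (suc n)) (cong (_* + suc n) (pos-* m m)))
                     (cong (_+ 1ℤ) (pos-* 2 m)))))))))

  -- 6 K₀ K₂² m (m + 1) (m - 1)² = 3 K₂³ m² (m - 1)³ (2m + 2), which beats the 2m + 1 of the other type.
  multiplicity≤sepSum₂₂ : ∀ {X Y} → X ≢ Y → ∀ {a₁ a₂ b₁ b₂} → a₁ ≢ a₂ → b₁ ≢ b₂ →
    + multiplicity ≤ sepSum n (X , a₁) (Y , b₁) (X , a₂) (Y , b₂)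
  multiplicity≤sepSum₂₂ {X} {Y} X≢Y {a₁} {a₂} {b₁} {b₂} a₁≢a₂ b₁≢b₂ = *-cancelˡ-≤-pos _ _ (+ 3) (begin
    + 3 * + multiplicity
      ≡⟨ cong (+ 3 *_) multiplicity-ℤ ⟩
    + 3 * (K₁ * (K₁ * (K₂ * (M * M * (M - 1ℤ) * (+ 2 * M + 1ℤ)))))
      ≡⟨ sym (+-identityʳ _) ⟩
    + 3 * (K₁ * (K₁ * (K₂ * (M * M * (M - 1ℤ) * (+ 2 * M + 1ℤ))))) + 0ℤ
      ≤⟨ +-monoʳ-≤ (+ 3 * (K₁ * (K₁ * (K₂ * (M * M * (M - 1ℤ) * (+ 2 * M + 1ℤ)))))) surplus-nonneg ⟩
    + 3 * (K₁ * (K₁ * (K₂ * (M * M * (M - 1ℤ) * (+ 2 * M + 1ℤ))))) + surplus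
      ≡⟨ cong (λ k → + 3 * (k * (k * (K₂ * (M * M * (M - 1ℤ) * (+ 2 * M + 1ℤ))))) + surplus) (pos-* (suc n) (n !)) ⟩
    + 3 * (S * K₂ * (S * K₂ * (K₂ * (M * M * (M - 1ℤ) * (+ 2 * M + 1ℤ))))) + surplus
      ≡⟨ solve 2 (λ S K → let M = con 1ℤ :+ S in
           con (+ 3) :* (S :* K :* (S :* K :* (K :* (M :* M :* (M :- con 1ℤ) :* (con (+ 2) :* M :+ con 1ℤ)))))
             :+ con (+ 3) :* (K :* (K :* (K :* (M :* (M :* (S :* (S :* S)))))))
           := con (+ 6) :* (M :* (S :* K) :* (K :* (K :* (M :* (M :+ con 1ℤ) :* ((M :- con 1ℤ) :* (M :- con 1ℤ)))))))
           refl S K₂ ⟩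
    + 6 * (M * (S * K₂) * (K₂ * (K₂ * (M * (M + 1ℤ) * ((M - 1ℤ) * (M - 1ℤ))))))
      ≡⟨ cong (λ k → + 6 * (k * (K₂ * (K₂ * (M * (M + 1ℤ) * ((M - 1ℤ) * (M - 1ℤ)))))))
           (sym (trans (pos-* m (suc n !)) (cong (M *_) (pos-* (suc n) (n !))))) ⟩
    + 6 * (K₀ * (K₂ * (K₂ * (M * (M + 1ℤ) * ((M - 1ℤ) * (M - 1ℤ))))))
      ≡⟨ sym (sepSum₂₂ n X≢Y a₁≢a₂ b₁≢b₂) ⟩
    + 3 * sepSum n (X , a₁) (Y , b₁) (X , a₂) (Y , b₂) ∎)
    where
    open ≤-Reasoning
    M S K₀ K₁ K₂ surplus : ℤ
    M = + m
    S = + suc n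
    K₀ = + (m !)
    K₁ = + (suc n !)
    K₂ = + (n !)
    surplus = + 3 * (K₂ * (K₂ * (K₂ * (M * (M * (S * (S * S)))))))
    +*-nonneg : ∀ k {x} → 0ℤ ≤ x → 0ℤ ≤ + k * x
    +*-nonneg k 0≤x = ≤-trans (≤-reflexive (sym (*-zeroʳ (+ k)))) (*-monoˡ-≤-nonNeg (+ k) 0≤x)
    surplus-nonneg : 0ℤ ≤ surplus
    surplus-nonneg = +*-nonneg 3 (+*-nonneg (n !) (+*-nonneg (n !) (+*-nonneg (n !) (+*-nonneg m (+*-nonneg m
      (+*-nonneg (suc n) (+*-nonneg (suc n) {S} (+≤+ ℕ.z≤n))))))))

  multiplicity≤sepSum-sharing : ∀ {X Y Z} → X ≢ Y → X ≢ Z → ∀ {a₁ a₂ b c} → (X , a₁) ≢ (X , a₂) → (Y , b) ≢ (Z , c) →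
    + multiplicity ≤ sepSum n (X , a₁) (Y , b) (X , a₂) (Z , c)
  multiplicity≤sepSum-sharing {X} {Y} {Z} X≢Y X≢Z a₁≢a₂ b≢c with Y Fin.≟ Z
  ... | yes refl = multiplicity≤sepSum₂₂ X≢Y (a₁≢a₂ ∘ cong (X ,_)) (b≢c ∘ cong (Y ,_))
  ... | no Y≢Z   = ≤-reflexive (trans multiplicity-ℤ
    (sym (sepSum₂₁₁ n (distinct⇒IsPerm X≢Y X≢Z Y≢Z) (a₁≢a₂ ∘ cong (X ,_)) _ _)))

  private
    swapˡ-sum : ∀ u v u′ v′ → sepSum n u v u′ v′ ≡ sepSum n v u u′ v′
    swapˡ-sum u v u′ v′ = ∑ₗ-cong (orderings m) λ σ → sep-swapˡ (pos σ u) (pos σ v) (pos σ u′) (pos σ v′)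

    swapʳ-sum : ∀ u v u′ v′ → sepSum n u v u′ v′ ≡ sepSum n u v v′ u′
    swapʳ-sum u v u′ v′ = ∑ₗ-cong (orderings m) λ σ → sep-swapʳ (pos σ u) (pos σ v) (pos σ u′) (pos σ v′)

  -- Each edge misses just one of the three parts, so two edges share a part. Exchanging ends within
  -- an edge brings the shared part to the front of both.
  multiplicity≤sepSum : ∀ e f → Nonincident e f → + multiplicity ≤ sepSum n (end₁ e) (end₂ e) (end₁ f) (end₂ f)
  multiplicity≤sepSum (edge (p₁ , x₁) (p₂ , x₂) p₁≢p₂) (edge (q₁ , y₁) (q₂ , y₂) q₁≢q₂) (n₁₁ , n₁₂ , n₂₁ , n₂₂)
    with p₁ Fin.≟ q₁ | p₁ Fin.≟ q₂ | p₂ Fin.≟ q₁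
  ... | yes refl | _ | _ = multiplicity≤sepSum-sharing p₁≢p₂ q₁≢q₂ n₁₁ n₂₂
  ... | no _ | yes refl | _ = ≤-trans (multiplicity≤sepSum-sharing p₁≢p₂ (q₁≢q₂ ∘ sym) n₁₂ n₂₁)
    (≤-reflexive (swapʳ-sum (p₁ , x₁) (p₂ , x₂) (q₂ , y₂) (q₁ , y₁)))
  ... | no _ | no _ | yes refl = ≤-trans (multiplicity≤sepSum-sharing (p₁≢p₂ ∘ sym) q₁≢q₂ n₂₁ n₁₂)
    (≤-reflexive (swapˡ-sum (p₂ , x₂) (p₁ , x₁) (q₁ , y₁) (q₂ , y₂)))
  ... | no p₁≢q₁ | no p₁≢q₂ | no p₂≢q₁
    with refl ← noFourth (distinct⇒IsPerm p₁≢q₁ p₁≢p₂ (p₂≢q₁ ∘ sym)) p₁≢q₂ q₁≢q₂ =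
    ≤-trans (multiplicity≤sepSum-sharing (p₁≢p₂ ∘ sym) (q₁≢q₂ ∘ sym) n₂₂ n₁₁)
    (≤-reflexive (trans (swapˡ-sum (p₂ , x₂) (p₁ , x₁) (q₂ , y₂) (q₁ , y₁)) (swapʳ-sum (p₁ , x₁) (p₂ , x₂) (q₂ , y₂) (q₁ , y₁))))

  repeated : ℕ → List (LinearOrdering m)
  repeated N = concat (replicate N (orderings m))

  repeated-separates : ∀ N → SeparatesAll (N ℕ.* multiplicity) (repeated N)
  repeated-separates N e f nonincident = drop‿+≤+ (begin
    + (N ℕ.* multiplicity)      ≡⟨ pos-* N multiplicity ⟩
    + N * + multiplicity        ≤⟨ *-monoˡ-≤-nonNeg (+ N) (multiplicity≤sepSum e f nonincident) ⟩
    + N * sepSum n (end₁ e) (end₂ e) (end₁ f) (end₂ f)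
      ≡⟨ sym (∑ₗ-concat-replicate N (orderings m) λ σ → sep (pos σ (end₁ e)) (pos σ (end₂ e)) (pos σ (end₁ f)) (pos σ (end₂ f))) ⟩
    ∑ₗ (repeated N) (λ σ → sep (pos σ (end₁ e)) (pos σ (end₂ e)) (pos σ (end₁ f)) (pos σ (end₂ f)))
      ≡⟨ sym (separates-sum (repeated N) e f) ⟩
    + sepCount (repeated N) e f ∎)
    where open ≤-Reasoning

  -- The equality case of the lower bound at t = `N * multiplicity`: these lists are optimal, not
  -- merely asymptotically so.
  length-repeated : ∀ N → length (repeated N) ℕ.* suc (2 ℕ.* m) ≡ 6 ℕ.* m ℕ.* (N ℕ.* multiplicity)
  length-repeated N = +-injective (begin
    + (length (repeated N) ℕ.* suc (2 ℕ.* m))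
      ≡⟨ trans (pos-* (length (repeated N)) (suc (2 ℕ.* m))) (cong₂ _*_ length≡ (cong (λ k → 1ℤ + k) (pos-* 2 m))) ⟩
    + N * (+ 6 * (K₀ * (K₀ * (K₀ * 1ℤ)))) * (1ℤ + + 2 * M)
      ≡⟨ cong (λ k → + N * (+ 6 * (k * (k * (k * 1ℤ)))) * (1ℤ + + 2 * M))
           (trans (pos-* m (suc n !)) (cong (M *_) (pos-* (suc n) (n !)))) ⟩
    + N * (+ 6 * (M * (S * K₂) * (M * (S * K₂) * (M * (S * K₂) * 1ℤ)))) * (1ℤ + + 2 * M)
      ≡⟨ solve 3 (λ N S K → let M = con 1ℤ :+ S in
           N :* (con (+ 6) :* (M :* (S :* K) :* (M :* (S :* K) :* (M :* (S :* K) :* con 1ℤ)))) :* (con 1ℤ :+ con (+ 2) :* M)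
           := con (+ 6) :* M :* (N :* (S :* K :* (S :* K :* (K :* (M :* M :* (M :- con 1ℤ) :* (con (+ 2) :* M :+ con 1ℤ)))))))
           refl (+ N) S K₂ ⟩
    + 6 * M * (+ N * (S * K₂ * (S * K₂ * (K₂ * (M * M * (M - 1ℤ) * (+ 2 * M + 1ℤ))))))
      ≡⟨ cong (λ k → + 6 * M * (+ N * (k * (k * (K₂ * (M * M * (M - 1ℤ) * (+ 2 * M + 1ℤ))))))) (sym (pos-* (suc n) (n !))) ⟩
    + 6 * M * (+ N * (K₁ * (K₁ * (K₂ * (M * M * (M - 1ℤ) * (+ 2 * M + 1ℤ))))))
      ≡⟨ cong (λ k → + 6 * M * (+ N * k)) (sym multiplicity-ℤ) ⟩
    + 6 * M * (+ N * + multiplicity)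
      ≡⟨ sym (trans (pos-* (6 ℕ.* m) (N ℕ.* multiplicity)) (cong₂ _*_ (pos-* 6 m) (pos-* N multiplicity))) ⟩
    + (6 ℕ.* m ℕ.* (N ℕ.* multiplicity)) ∎)
    where
    open ≡-Reasoning
    M S K₀ K₁ K₂ : ℤ
    M = + m
    S = + suc n
    K₀ = + (m !)
    K₁ = + (suc n !)
    K₂ = + (n !)
    length≡ : + length (repeated N) ≡ + N * (+ 6 * (K₀ * (K₀ * (K₀ * 1ℤ))))
    length≡ = begin
      + length (repeated N)               ≡⟨ length-∑ₗ (repeated N) ⟩
      ∑ₗ (repeated N) (const 1ℤ)          ≡⟨ ∑ₗ-concat-replicate N (orderings m) (const 1ℤ) ⟩
      + N * ∑ₗ (orderings m) (const 1ℤ)   ≡⟨ cong (+ N *_) (∑ₗ-orderings m (const 1ℤ)) ⟩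
      + N * ∑ₗ (perms 3) (λ s → ∑₃ (perms m) λ _ _ _ → 1ℤ)
        ≡⟨ cong (+ N *_) (∑-const-perms 3 (∑₃ (perms m) λ _ _ _ → 1ℤ)) ⟩
      + N * (+ 6 * ∑₃ (perms m) λ _ _ _ → 1ℤ)
        ≡⟨ cong (λ k → + N * (+ 6 * k)) (trans (∑-const-perms m (∑ₗ (perms m) λ _ → ∑ₗ (perms m) λ _ → 1ℤ)) (cong (K₀ *_)
             (trans (∑-const-perms m (∑ₗ (perms m) λ _ → 1ℤ)) (cong (K₀ *_) (∑-const-perms m 1ℤ))))) ⟩
      + N * (+ 6 * (K₀ * (K₀ * (K₀ * 1ℤ)))) ∎

-- The lower bound

bounded : ∀ {n} (f : Fin n → ℕ) → ∃ λ N → ∀ i → f i ℕ.< N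
bounded {zero}  f = 0 , λ ()
bounded {suc n} f with bounded (f ∘ suc)
... | N , f<N = suc (f zero) ℕ.⊔ N , λ
  { zero    → ℕ.m≤m⊔n (suc (f zero)) N
  ; (suc i) → ℕ.≤-trans (f<N i) (ℕ.m≤n⊔m (suc (f zero)) N)
  }

-- Supplies the end of the scan, where every vertex has been counted.
bounded₂ : ∀ {k m} (P : Fin k → Fin m → ℕ) → ∃ λ N → ∀ X x → P X x ℕ.< N
bounded₂ P with bounded (λ X → proj₁ (bounded (P X)))
... | N , bound<N = N , λ X x → ℕ.<-trans (proj₂ (bounded (P X)) x) (bound<N X)

sumPerms-mono : ∀ {f g : Fin 3 → Fin 3 → Fin 3 → ℤ} → (∀ {X Y Z} → IsPerm X Y Z → f X Y Z ≤ g X Y Z) →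
                sumPerms f ≤ sumPerms g
sumPerms-mono f≤g = +-mono-≤ (+-mono-≤ (+-mono-≤ (+-mono-≤ (+-mono-≤
  (f≤g p012) (f≤g p021)) (f≤g p102)) (f≤g p120)) (f≤g p201)) (f≤g p210)

∑ₗ-sumPerms : ∀ {A : Set} (xs : List A) (F : A → Fin 3 → Fin 3 → Fin 3 → ℤ) →
  ∑ₗ xs (λ x → sumPerms (F x)) ≡ sumPerms λ X Y Z → ∑ₗ xs (λ x → F x X Y Z)
∑ₗ-sumPerms xs F = extend (extend (extend (extend (∑ₗ-distrib-+ xs (λ x → F x 0F 1F 2F) (λ x → F x 0F 2F 1F)))))
  where
  extend : ∀ {f g y} → ∑ₗ xs f ≡ y → ∑ₗ xs (λ x → f x + g x) ≡ y + ∑ₗ xs g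
  extend {f} {g} eq = trans (∑ₗ-distrib-+ xs f g) (cong (_+ ∑ₗ xs g) eq)

∑₄-∑ₗ : ∀ {A : Set} {m} (xs : List A) (F : Fin m → Fin m → Fin m → Fin m → A → ℤ) →
  ∑₄ m (λ x y z w → ∑ₗ xs (F x y z w)) ≡ ∑ₗ xs λ a → ∑₄ m λ x y z w → F x y z w a
∑₄-∑ₗ {A} {m} xs F = trans (∑∑-cong λ x y → ∑∑-∑ₗ (F x y)) (∑∑-∑ₗ λ x y a → ∑[ z < m ] ∑[ w < m ] F x y z w a)
  where
  ∑∑-∑ₗ : (f : Fin m → Fin m → A → ℤ) → ∑[ x < m ] ∑[ y < m ] ∑ₗ xs (f x y) ≡ ∑ₗ xs λ a → ∑[ x < m ] ∑[ y < m ] f x y a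
  ∑∑-∑ₗ f = trans (sum-cong-≗ λ x → ∑-∑ₗ xs (f x)) (∑-∑ₗ xs λ x a → ∑[ y < m ] f x y a)

∑-nonneg : ∀ {n} {f : Fin n → ℤ} → (∀ i → 0ℤ ≤ f i) → 0ℤ ≤ sum f
∑-nonneg {n} 0≤f = ≤-trans (≤-reflexive (sym (*-zeroʳ (+ n)))) (∑-lower 0ℤ 0≤f)

∑-off-diagonal : ∀ {n} (k : Fin (suc n)) (f : Fin (suc n) → ℤ) → 0ℤ ≤ f k → ∀ c → (∀ i → k ≢ i → c ≤ f i) → + n * c ≤ sum f
∑-off-diagonal {n} k f 0≤fk c c≤f = begin
  + n * c                              ≡⟨ sym (+-identityˡ (+ n * c)) ⟩
  0ℤ + + n * c                         ≤⟨ +-mono-≤ 0≤fk (∑-lower c λ i → c≤f (punchIn k i) (Fin.punchInᵢ≢i k i ∘ sym)) ⟩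
  f k + ∑[ i < n ] f (punchIn k i)     ≡⟨ sym (sum-remove {i = k} f) ⟩
  sum f                                ∎
  where open ≤-Reasoning

module LowerBound (n t : ℕ) (L : List (LinearOrdering (2 ℕ.+ n))) (separatesAll : SeparatesAll t L) where
  private
    m = 2 ℕ.+ n
    M T : ℤ
    M = + m
    T = + t

  place : LinearOrdering m → Fin 3 → Fin m → ℕ
  place σ X x = pos σ (X , x)

  #sepOf : LinearOrdering m → Fin 3 → Fin 3 → Fin 3 → ℤ
  #sepOf σ = Placement.#sep (place σ)

  #sepOf-bound : ∀ σ → sumPerms (#sepOf σ) ≤ M * M * (M - 1ℤ) * (+ 2 * M + 1ℤ)
  #sepOf-bound σ with bounded₂ (place σ)
  ... | N , P<N = Placement.sumPerms-#sep-bound (place σ) (inj σ) P<N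

  -- Quadruples with `x` distinct from `x′` are nonincident pairs and yield at least `t` each; the
  -- diagonal ones are only bounded by zero. This leaves m³ (m - 1) useful quadruples.
  ∑-#sepOf : ∀ {X Y Z} → IsPerm X Y Z → M * (+ suc n * (M * (M * T))) ≤ ∑ₗ L (λ σ → #sepOf σ X Y Z)
  ∑-#sepOf {X} {Y} {Z} perm = ≤-trans
    (∑-lower _ λ x → ∑-off-diagonal x (λ x′ → ∑[ y < m ] ∑[ z < m ] times x x′ y z)
      (∑-nonneg λ y → ∑-nonneg λ z → times-nonneg x x y z) (M * (M * T))
      λ x′ x≢x′ → ∑-lower (M * T) λ y → ∑-lower T λ z → t≤times x x′ x≢x′ y z)
    (≤-reflexive (∑₄-∑ₗ L λ x x′ y z σ → sep (pos σ (X , x)) (pos σ (Y , y)) (pos σ (X , x′)) (pos σ (Z , z))))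
    where
    times : Fin m → Fin m → Fin m → Fin m → ℤ
    times x x′ y z = ∑ₗ L λ σ → sep (pos σ (X , x)) (pos σ (Y , y)) (pos σ (X , x′)) (pos σ (Z , z))
    XY : Fin m → Fin m → Edge m
    XY x y = edge (X , x) (Y , y) (IsPerm⇒≢ perm .proj₁)
    XZ : Fin m → Fin m → Edge m
    XZ x z = edge (X , x) (Z , z) (IsPerm⇒≢ perm .proj₂ .proj₁)
    times≡ : ∀ x x′ y z → + sepCount L (XY x y) (XZ x′ z) ≡ times x x′ y z
    times≡ x x′ y z = separates-sum L (XY x y) (XZ x′ z)
    times-nonneg : ∀ x x′ y z → 0ℤ ≤ times x x′ y z
    times-nonneg x x′ y z = ≤-trans (+≤+ ℕ.z≤n) (≤-reflexive (times≡ x x′ y z))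
    t≤times : ∀ x x′ → x ≢ x′ → ∀ y z → T ≤ times x x′ y z
    t≤times x x′ x≢x′ y z = ≤-trans (+≤+ (separatesAll (XY x y) (XZ x′ z)
      -- Only the two vertices of the shared part could coincide; all other endpoints to be compared
      -- lie in different parts.
      ( (λ { refl → x≢x′ refl })
      , (λ eq → IsPerm⇒≢ perm .proj₂ .proj₁ (cong proj₁ eq))
      , (λ eq → IsPerm⇒≢ perm .proj₁ (sym (cong proj₁ eq)))
      , (λ eq → IsPerm⇒≢ perm .proj₂ .proj₂ (cong proj₁ eq)))))
      (≤-reflexive (times≡ x x′ y z))

  -- Double counting of separations, with the common factor m² (m - 1) cancelled. The bound is
  -- cross-multiplied and holds for every `t`.
  lowerBound : 6 ℕ.* m ℕ.* t ℕ.≤ length L ℕ.* suc (2 ℕ.* m)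
  lowerBound = drop‿+≤+ (*-cancelˡ-≤-pos _ _ (+ (m ℕ.* m ℕ.* suc n)) (begin
    + (m ℕ.* m ℕ.* suc n) * + (6 ℕ.* m ℕ.* t)
      ≡⟨ cong₂ _*_ mmn (trans (pos-* (6 ℕ.* m) t) (cong (_* T) (pos-* 6 m))) ⟩
    M * M * S * (+ 6 * M * T)
      ≡⟨ solve 3 (λ M S T → let c = M :* (S :* (M :* (M :* T))) in
           M :* M :* S :* (con (+ 6) :* M :* T) := c :+ c :+ c :+ c :+ c :+ c) refl M S T ⟩
    sumPerms (λ _ _ _ → M * (S * (M * (M * T))))
      ≤⟨ sumPerms-mono {f = λ _ _ _ → M * (S * (M * (M * T)))} {g = λ X Y Z → ∑ₗ L (λ σ → #sepOf σ X Y Z)} ∑-#sepOf ⟩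
    sumPerms (λ X Y Z → ∑ₗ L (λ σ → #sepOf σ X Y Z))
      ≡⟨ sym (∑ₗ-sumPerms L #sepOf) ⟩
    ∑ₗ L (λ σ → sumPerms (#sepOf σ))
      ≤⟨ ∑ₗ-mono L #sepOf-bound ⟩
    ∑ₗ L (const (M * M * (M - 1ℤ) * (+ 2 * M + 1ℤ)))
      ≡⟨ ∑ₗ-const L _ ⟩
    + length L * (M * M * S * (+ 2 * M + 1ℤ))
      ≡⟨ solve 3 (λ l c M → l :* (c :* (con (+ 2) :* M :+ con 1ℤ)) := c :* (l :* (con 1ℤ :+ con (+ 2) :* M))) refl (+ length L) (M * M * S) M ⟩
    M * M * S * (+ length L * (1ℤ + + 2 * M))
      ≡⟨ sym (cong₂ _*_ mmn (trans (pos-* (length L) (suc (2 ℕ.* m))) (cong (λ k → + length L * (1ℤ + k)) (pos-* 2 m)))) ⟩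
    + (m ℕ.* m ℕ.* suc n) * + (length L ℕ.* suc (2 ℕ.* m)) ∎))
    where
    open ≤-Reasoning
    S : ℤ
    S = + suc n
    mmn : + (m ℕ.* m ℕ.* suc n) ≡ M * M * S
    mmn = trans (pos-* (m ℕ.* m) (suc n)) (cong (_* S) (pos-* m m))

open LowerBound using (lowerBound)

-- The limit inferior

/-mono-≤ : ∀ a b c d → a ℕ.* suc d ℕ.≤ c ℕ.* suc b → (+ a) / suc b ℚ.≤ (+ c) / suc d
/-mono-≤ a b c d ad≤cb = ℚ.toℚᵘ-cancel-≤ (begin
  toℚᵘ ((+ a) / suc b)  ≃⟨ ℚ.toℚᵘ-fromℚᵘ (mkℚᵘ (+ a) b) ⟩
  mkℚᵘ (+ a) b          ≤⟨ ℚᵘ.*≤* ad≤cb′ ⟩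
  mkℚᵘ (+ c) d          ≃⟨ ℚᵘ.≃-sym (ℚ.toℚᵘ-fromℚᵘ (mkℚᵘ (+ c) d)) ⟩
  toℚᵘ ((+ c) / suc d)  ∎)
  where
  open ℚᵘ.≤-Reasoning
  ad≤cb′ : + a * + suc d ≤ + c * + suc b
  ad≤cb′ = subst₂ _≤_ (pos-* a (suc d)) (pos-* c (suc b)) (+≤+ ad≤cb)

fracSepDim : ∀ n → FracSepDimIs (2 ℕ.+ n) ((+ (6 ℕ.* (2 ℕ.+ n))) / suc (2 ℕ.* (2 ℕ.+ n)))
fracSepDim n = lower , upper
  where
  m = 2 ℕ.+ n
  q : ℚ
  q = (+ (6 ℕ.* m)) / suc (2 ℕ.* m)

  lower : ∀ ε → ℚ.Positive ε → ∃ λ N → ∀ t k → N ℕ.≤ t → IsPi m (suc t) k → q ℚ.- ε ℚ.≤ (+ k) / suc t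
  -- The ratio is at least `q` for every `t`, so the threshold is 0 and `ε` is simply dropped.
  lower ε ε>0 = 0 , λ { t k _ ((L , refl , separatesAll) , _) → begin
    q ℚ.- ε                   ≤⟨ ℚ.+-monoʳ-≤ q (ℚ.neg-antimono-≤ (ℚ.<⇒≤ (ℚ.positive⁻¹ ε {{ε>0}}))) ⟩
    q ℚ.+ ℚ.0ℚ                ≡⟨ ℚ.+-identityʳ q ⟩
    q                         ≤⟨ /-mono-≤ (6 ℕ.* m) (2 ℕ.* m) (length L) t (lowerBound n (suc t) L separatesAll) ⟩
    (+ length L) / suc t      ∎ }
    where open ℚ.≤-Reasoning

  upper : ∀ ε → ℚ.Positive ε → ∀ N → ∃ λ t → ∃ λ k → N ℕ.≤ t × IsPi m (suc t) k × ((+ k) / suc t ℚ.≤ q ℚ.+ ε)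
  upper ε ε>0 N = t , length L , ℕ.≤-pred (subst (suc N ℕ.≤_) (sym suc-t) (ℕ.m≤m*n (suc N) (multiplicity n))) ,
    ((L , refl , subst (λ u → SeparatesAll u L) (sym suc-t) (repeated-separates n (suc N))) , minimal) ,
    ℚ.≤-trans (/-mono-≤ (length L) t (6 ℕ.* m) (2 ℕ.* m) (ℕ.≤-reflexive length-L))
      (subst (ℚ._≤ q ℚ.+ ε) (ℚ.+-identityʳ q) (ℚ.+-monoʳ-≤ q (ℚ.<⇒≤ (ℚ.positive⁻¹ ε {{ε>0}}))))
    where
    instance
      multiplicity≢0 : ℕ.NonZero (multiplicity n)
      multiplicity≢0 = ℕ.m*n≢0 (suc n !) _ {{suc n ℕ.!≢0}} {{ℕ.m*n≢0 (suc n !) _ {{suc n ℕ.!≢0}} {{ℕ.m*n≢0 (n !) _ {{n ℕ.!≢0}}}}}}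
    L : List (LinearOrdering m)
    L = repeated n (suc N)
    t : ℕ
    -- The definition tests `suc t`, hence the predecessor. Using `suc N` copies keeps the product
    -- positive and makes it at least `suc N`, so that N ≤ t.
    t = ℕ.pred (suc N ℕ.* multiplicity n)
    suc-t : suc t ≡ suc N ℕ.* multiplicity n
    suc-t = ℕ.suc-pred (suc N ℕ.* multiplicity n) {{ℕ.m*n≢0 (suc N) (multiplicity n)}}
    length-L : length L ℕ.* suc (2 ℕ.* m) ≡ 6 ℕ.* m ℕ.* suc t
    length-L = trans (length-repeated n (suc N)) (cong (6 ℕ.* m ℕ.*_) (sym suc-t))
    -- The lower bound for `L′` is compared with the equality for `L`, so that the common factor 2m
    -- + 1 cancels.
    minimal : ∀ L′ → SeparatesAll (suc t) L′ → length L ℕ.≤ length L′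
    minimal L′ separatesAll = ℕ.*-cancelʳ-≤ (length L) (length L′) (suc (2 ℕ.* m))
      (ℕ.≤-trans (ℕ.≤-reflexive length-L) (lowerBound n (suc t) L′ separatesAll))

mainTheorem11 : ∀ (m : ℕ) → 2 ℕ.≤ m → FracSepDimIs m ((+ (6 ℕ.* m)) / suc (2 ℕ.* m))
mainTheorem11 (suc (suc n)) (ℕ.s≤s (ℕ.s≤s _)) = fracSepDim n
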